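{- Let $R$ be a region (without defects) consisting of $n$ cells. Then the region $R^{\boxplus}$ has a cover by L-trominoes if and only if $3\mid n$.
   Context: A cell is a unit square $[i,i+1]\times[j,j+1]$ with $i,j\in\mathbb{Z}$, labelled $(i,j)$. A region is a finite set of cells whose union is connected (equivalently, whose graph with edges between cells $(i,j),(i',j')$ with $|i-i'|+|j-j'|=1$ is connected). An L-tromino is a set of three cells equal to a $2\times 2$ block of cells with one cell removed (any of the four orientations). A cover of a region is a partition of it into L-trominoes. For a region $R$, $R^{\boxplus}$ is the region obtained by subdividing each cell into four cells, i.e. $R^{\boxplus}=\{(2i+s,2j+t): (i,j)\in R,\ s,t\in\{0,1\}\}$. -}

module Defs where

open import Data.Integer using (ℤ; +_; 1ℤ; _+_; _-_; _*_; ∣_∣)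
import Data.Nat as ℕ
open import Data.List using (List; _∷_; []; length; concat; concatMap; cartesianProduct)
open import Data.List.Membership.Propositional using (_∈_)
open import Data.List.Relation.Binary.BagAndSetEquality using (_∼[_]_; set)
open import Data.List.Relation.Binary.Disjoint.Propositional using (Disjoint)
open import Data.List.Relation.Unary.All using (All)
open import Data.List.Relation.Unary.AllPairs using (AllPairs)
open import Data.List.Relation.Unary.Unique.Propositional using (Unique)
open import Data.Product using (_×_; _,_; ∃₂)
open import Function.Bundles using (_⇔_)
open import Relation.Binary.Construct.Closure.ReflexiveTransitive using (Star)
open import Relation.Binary.PropositionalEquality using (_≡_; _≢_)

-- (i , j) stands for the unit square [i, i+1] × [j, j+1].
Cell : Set
Cell = ℤ × ℤ

Adjacent : Cell → Cell → Set
Adjacent (i , j) (i′ , j′) = ∣ i - i′ ∣ ℕ.+ ∣ j - j′ ∣ ≡ 1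

-- Edges of the graph induced on a finite set of cells.
AdjacentIn : List Cell → Cell → Cell → Set
AdjacentIn S c d = c ∈ S × d ∈ S × Adjacent c d

-- A finite set of cells is a list, read up to membership; duplicate-freeness
-- makes the length of the list the number of cells.
record Region : Set where
  field
    cells     : List Cell
    unique    : Unique cells
    connected : ∀ {c d} → c ∈ cells → d ∈ cells → Star (AdjacentIn cells) c d

open Region public

size : Region → ℕ.ℕ
size R = length (cells R)

-- The 2 × 2 block { (i + s , j + t) : s, t ∈ {0, 1} }.
block : Cell → List Cell
block (i , j) = cartesianProduct (i ∷ i + 1ℤ ∷ []) (j ∷ j + 1ℤ ∷ [])

IsLTromino : List Cell → Set
IsLTromino T = ∃₂ λ b m → m ∈ block b × (∀ c → c ∈ T ⇔ (c ∈ block b × c ≢ m))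

-- L-trominoes are nonempty, so pairwise disjointness also rules out
-- a piece being listed twice.
record Cover (S : List Cell) : Set where
  field
    pieces    : List (List Cell)
    trominoes : All IsLTromino pieces
    disjoint  : AllPairs Disjoint pieces
    union     : concat pieces ∼[ set ] S

_⊞ : Region → List Cell
R ⊞ = concatMap (λ (i , j) → block (+ 2 * i , + 2 * j)) (cells R)

{-# OPTIONS --safe #-}
module Submission where

-- For necessity, |R⊞| = 4n. For sufficiency, use induction on n. If R contains a 2 × 2 block of cells, spread the four
-- cells of the block to four connected parts of R, cyclically adjacent. By the pigeonhole principle for prefix sums
-- mod 3, the union of some cyclic interval of parts has a size divisible by 3; it and its complement are connected and
-- are covered separately. If R contains no such block, take a spanning tree of R, rooted at a lowest cell. By
-- induction, the cells of a branch are covered inside the branch (size 0 mod 3), or up to one fine cell bordering the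
-- parent (size 1), or up to both such cells, or together with one fine cell of the parent (size 2). At a node, the
-- branches are joined by trominoes inside its 2 × 2 square or around its corners; the absence of blocks is what
-- prevents two branches from competing for the same fine cell.

open import Defs
open import Data.Empty using (⊥; ⊥-elim)
open import Data.Fin using (zero; suc; #_)
open import Data.Integer as ℤ using (ℤ; +_; -[1+_]; 0ℤ; 1ℤ; -1ℤ; _+_; _-_; _*_; ∣_∣)
import Data.Integer.Properties as ℤ
open import Data.Integer.Tactic.RingSolver using (solve-∀)
open import Data.List using (List; []; _∷_; [_]; _++_; concat; concatMap; length)
import Data.List.Membership.DecPropositional as DecMembership
open import Data.List.Membership.Propositional using (_∈_; _∉_; lose)
open import Data.List.Membership.Propositional.Properties
  using (∈-++⁺ˡ; ∈-++⁺ʳ; ∈-++⁻; ∈-∃++; ∈-length; ∈-concat⁺′; ∈-concat⁻′; ∈-cartesianProduct⁻)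
open import Data.List.Membership.Propositional.Properties.WithK using (unique∧set⇒bag)
open import Data.List.Properties using (length-++; concatMap-++; ++-identityʳ)
open import Data.List.Relation.Binary.BagAndSetEquality
  using (_∼[_]_; set; ∼bag⇒↭; ↭⇒∼bag; bag-=⇒; ++-cong)
open import Data.List.Relation.Binary.Disjoint.Propositional using (Disjoint)
open import Data.List.Relation.Binary.Permutation.Propositional as Perm
  using (_↭_; ↭-refl; ↭-sym; ↭-trans; ↭-reflexive; prep; swap; ↭⇒↭ₛ)
open import Data.List.Relation.Binary.Permutation.Propositional.Properties
  using (++-commutativeMonoid; ++⁺; ++⁺ˡ; ++⁺ʳ; ++-assoc; shift; shifts; All-resp-↭; ∈-resp-↭; ↭-length)
import Data.List.Relation.Binary.Permutation.Setoid.Properties as SetoidPerm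
open import Data.List.Relation.Unary.All as All using (All; []; _∷_)
import Data.List.Relation.Unary.All.Properties as All
open import Data.List.Relation.Unary.AllPairs as AllPairs using (AllPairs; []; _∷_)
import Data.List.Relation.Unary.AllPairs.Properties as AllPairs
open import Data.List.Relation.Unary.Any as Any using (any?; here; there)
open import Data.List.Relation.Unary.Unique.Propositional using (Unique)
import Data.List.Relation.Unary.Unique.Propositional.Properties as Unique
import Data.Nat as ℕ
open import Data.Nat using (ℕ)
open import Data.Nat.DivMod using (_divMod_; result)
open import Data.Nat.Divisibility using (_∣_; divides; ∣m+n∣m⇒∣n; ∣m∣n⇒∣m+n; ∣n⇒∣m*n; ∣⇒≤)
import Data.Nat.Properties as ℕ
import Data.Nat.Tactic.RingSolver as ℕ
open import Data.Product using (_×_; _,_; ∃; ∃₂; proj₁; proj₂)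
open import Data.Product.Properties using (≡-dec)
open import Data.Sum using (_⊎_; inj₁; inj₂)
open import Data.Unit using (⊤; tt)
open import Data.Vec using (Vec; []; _∷_)
open import Function using (id; _∘_)
open import Function.Bundles using (_⇔_; mk⇔; Equivalence)
open import Relation.Binary.Construct.Closure.ReflexiveTransitive using (Star; ε; _◅_; _◅◅_; map)
open import Relation.Binary.PropositionalEquality
  using (_≡_; _≢_; refl; sym; trans; cong; cong₂; subst; subst₂; setoid)
open import Relation.Nullary using (¬_; yes; no; contradiction)
open import Relation.Nullary.Decidable using (True; toWitness)

open import Algebra.Properties.AbelianGroup ℤ.+-0-abelianGroup using (∙-cancelʳ)
open import Algebra.Solver.CommutativeMonoid (++-commutativeMonoid {A = Cell})
  using (Expr; var; _⊕_; ⟦_⟧; ⟦_⟧⇓; normalise; normalise-correct; _≟_; solve; _⊜_)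
open DecMembership (≡-dec ℤ._≟_ ℤ._≟_) using (_∈?_)

-- Trominoes and tilings

Square : Cell → Cell → Cell → Cell → Set
Square p q r s = ∃ λ b → p ∷ q ∷ r ∷ s ∷ [] ↭ block b

-- A duplicate-sensitive form of `IsLTromino`. Tilings are handled as multisets, so that
-- disjointness of the pieces follows once the tiled list has no duplicates.
Tromino : List Cell → Set
Tromino T = ∃₂ λ b m → m ∷ T ↭ block b

data Tiled : List Cell → Set where
  []   : Tiled []
  tile : ∀ {T S} → Tromino T → Tiled S → Tiled (T ++ S)
  resp : ∀ {S S′} → S ↭ S′ → Tiled S → Tiled S′

_++ᵗ_ : ∀ {S S′} → Tiled S → Tiled S′ → Tiled (S ++ S′)
[]       ++ᵗ q = q
_++ᵗ_ {S′ = S′} (tile {T} {S} t p) q = resp (↭-sym (++-assoc T S S′)) (tile t (p ++ᵗ q))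
_++ᵗ_ {S′ = S′} (resp e p) q = resp (++⁺ʳ S′ e) (p ++ᵗ q)

module _ {p q r s : Cell} where

  omit₁ : Square p q r s → Tiled (q ∷ r ∷ s ∷ [])
  omit₁ (b , e) = tile (b , p , e) []

  omit₂ : Square p q r s → Tiled (p ∷ r ∷ s ∷ [])
  omit₂ (b , e) = tile (b , q , ↭-trans (swap q p ↭-refl) e) []

  omit₃ : Square p q r s → Tiled (p ∷ q ∷ s ∷ [])
  omit₃ (b , e) = tile (b , r , ↭-trans (↭-sym (shift r (p ∷ q ∷ []) [ s ])) e) []

  omit₄ : Square p q r s → Tiled (p ∷ q ∷ r ∷ [])
  omit₄ (b , e) = tile (b , s , ↭-trans (↭-sym (shift s (p ∷ q ∷ r ∷ []) [])) e) []

-- S is tiled up to x, in continuation-passing form: any tiling that sticks into S exactly at x extends to all of S.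
Lacks₁ : Cell → List Cell → Set
Lacks₁ x S = ∀ {M} → Tiled (x ∷ M) → Tiled (M ++ S)

Lacks₂ : Cell → Cell → List Cell → Set
Lacks₂ x y S = ∀ {M} → Tiled (x ∷ y ∷ M) → Tiled (M ++ S)

-- Coordinates relative to a node of the spanning tree: its fine cells are at {0, 1}², its parent is below, and the
-- left, upper and right neighbours have fine cells at x = −1, y = 2 and x = 2. The frames of the children arise by
-- the following operations; all coordinates being literals, the changes of frame hold by computation.
Map : Set
Map = ℤ → ℤ → Cell

-- Used with `k = 0` on coarse cells, fixing the column of the node, and with `k = 1` on fine cells,
-- exchanging its two columns.
reflect : ℤ → Map → Map
reflect k F a b = F (k - a) b

-- The frame of the left child, with the node of `F` below it. One formula serves both scales:
-- coarse level 0 goes to column -1, fine levels 0 and 1 to columns -1 and -2.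
rotate : Map → Map
rotate F a b = F (-1ℤ - b) a

raise : ℤ → Map → Map
raise k F a b = F a (b + k)

Squares : Map → Set
Squares F = ∀ a b → Square (F a b) (F (a + 1ℤ) b) (F a (b + 1ℤ)) (F (a + 1ℤ) (b + 1ℤ))

perm₄ : ∀ {p q r s p′ q′ r′ s′} →
        p′ ∷ q′ ∷ r′ ∷ s′ ∷ [] ↭ p ∷ q ∷ r ∷ s ∷ [] → Square p q r s → Square p′ q′ r′ s′
perm₄ e (b , e′) = b , ↭-trans e e′

reflect-Squares : ∀ k F → Squares F → Squares (reflect k F)
reflect-Squares k F sq a b =
  perm₄ (swap _ _ (swap _ _ ↭-refl))
    (subst (λ c → Square (F a′ b) (F c b) (F a′ (b + 1ℤ)) (F c (b + 1ℤ))) (eq k a) (sq a′ b))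
  where
  a′ = k - (a + 1ℤ)
  eq : ∀ k a → (k - (a + 1ℤ)) + 1ℤ ≡ k - a
  eq = solve-∀

rotate-Squares : ∀ F → Squares F → Squares (rotate F)
rotate-Squares F sq a b =
  perm₄ (solve 4 (λ p q r s → (q ⊕ s ⊕ p ⊕ r) ⊜ (p ⊕ q ⊕ r ⊕ s)) ↭-refl
          [ F b′ a ] [ F (-1ℤ - b) a ] [ F b′ (a + 1ℤ) ] [ F (-1ℤ - b) (a + 1ℤ) ])
    (subst (λ c → Square (F b′ a) (F c a) (F b′ (a + 1ℤ)) (F c (a + 1ℤ))) (eq b) (sq b′ a))
  where
  b′ = -1ℤ - (b + 1ℤ)
  eq : ∀ a → (-1ℤ - (a + 1ℤ)) + 1ℤ ≡ -1ℤ - a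
  eq = solve-∀

raise-Squares : ∀ k F → Squares F → Squares (raise k F)
raise-Squares k F sq a b =
  subst (λ c → Square (F a (b + k)) (F (a + 1ℤ) (b + k)) (F a c) (F (a + 1ℤ) c)) (eq b k) (sq a (b + k))
  where
  eq : ∀ b k → (b + k) + 1ℤ ≡ (b + 1ℤ) + k
  eq = solve-∀

2ℤ : ℤ
2ℤ = + 2

flip : Map → Map
flip = reflect 1ℤ

-- Branches and how a node joins them

nodeCells : Map → List Cell → List Cell → List Cell → List Cell
nodeCells F SL SU SR = F 0ℤ 0ℤ ∷ F 1ℤ 0ℤ ∷ F 0ℤ 1ℤ ∷ F 1ℤ 1ℤ ∷ SL ++ SU ++ SR

-- What a left branch S offers to its parent node, by its size mod 3. The types Above and Here state that the parent
-- has an upper child and that the branch is nonempty. A right branch is described in the flipped frame.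
data Side (F : Map) (S : List Cell) (Above Here : Set) : Set where
  side₀ : Tiled S → Side F S Above Here
  side₁ : Tiled (F 0ℤ 0ℤ ∷ F 0ℤ 1ℤ ∷ S) → Lacks₁ (F -1ℤ 0ℤ) S → (Above → Lacks₁ (F -1ℤ 1ℤ) S) →
          Here → Side F S Above Here
  side₂ : Tiled (F 0ℤ 1ℤ ∷ S) → (Above → Tiled (F 0ℤ 0ℤ ∷ S)) → Here → Side F S Above Here

-- What an upper branch offers. `OnLeft` and `OnRight` state that the node has a child on that side;
-- each excludes the outcomes that depend on a child of the upper root on the same side, which makes
-- the further options available.
data Top (F : Map) (S : List Cell) (OnLeft Here OnRight : Set) : Set where
  top₀ : Tiled S → Top F S OnLeft Here OnRight
  top₁ : Tiled (F 0ℤ 1ℤ ∷ F 1ℤ 1ℤ ∷ S) → (OnLeft → Lacks₁ (F 0ℤ 2ℤ) S) → (OnRight → Lacks₁ (F 1ℤ 2ℤ) S) →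
         Here → Top F S OnLeft Here OnRight
  top₂ : Tiled (F 0ℤ 1ℤ ∷ S) ⊎ Tiled (F 1ℤ 1ℤ ∷ S) →
         (OnRight → Tiled (F 0ℤ 1ℤ ∷ S)) → (OnLeft → Tiled (F 1ℤ 1ℤ ∷ S)) →
         (OnLeft → OnRight → Lacks₂ (F 0ℤ 2ℤ) (F 1ℤ 2ℤ) S) → Here → Top F S OnLeft Here OnRight

-- How far the cells S of a branch with root frame F can be tiled. A branch of size 1 or 2 mod 3 may favour one side, but
-- only if the root has a child on the side that the constructor records.
data Outcome (F : Map) (S : List Cell) (OnLeft OnRight : Set) : Set where
  full     : Tiled S → Outcome F S OnLeft OnRight
  either   : Lacks₁ (F 0ℤ 0ℤ) S → Lacks₁ (F 1ℤ 0ℤ) S → Outcome F S OnLeft OnRight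
  left₁    : Lacks₁ (F 0ℤ 0ℤ) S → OnRight → Outcome F S OnLeft OnRight
  right₁   : Lacks₁ (F 1ℤ 0ℤ) S → OnLeft → Outcome F S OnLeft OnRight
  both     : Lacks₂ (F 0ℤ 0ℤ) (F 1ℤ 0ℤ) S → Outcome F S OnLeft OnRight
  left₂    : Tiled (F 0ℤ -1ℤ ∷ S) → OnLeft → Outcome F S OnLeft OnRight
  right₂   : Tiled (F 1ℤ -1ℤ ∷ S) → OnRight → Outcome F S OnLeft OnRight

Lacks₂-swap : ∀ {x y S} → Lacks₂ x y S → Lacks₂ y x S
Lacks₂-swap b p = b (resp (swap _ _ ↭-refl) p)

flip-Top : ∀ {F S P Q R} → Top F S P Q R → Top (flip F) S R Q P
flip-Top (top₀ p) = top₀ p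
flip-Top (top₁ p f g h) = top₁ (resp (swap _ _ ↭-refl) p) g f h
flip-Top (top₂ (inj₁ p) f g h k) = top₂ (inj₂ p) g f (λ r l → Lacks₂-swap (h l r)) k
flip-Top (top₂ (inj₂ p) f g h k) = top₂ (inj₁ p) g f (λ r l → Lacks₂-swap (h l r)) k

unflip-Outcome : ∀ {F S P Q} → Outcome (flip F) S P Q → Outcome F S Q P
unflip-Outcome (full p) = full p
unflip-Outcome (either p q) = either q p
unflip-Outcome (left₁ p q) = right₁ p q
unflip-Outcome (right₁ p q) = left₁ p q
unflip-Outcome (both p) = both (Lacks₂-swap p)
unflip-Outcome (left₂ p q) = right₂ p q
unflip-Outcome (right₂ p q) = left₂ p q

Outcome-resp : ∀ {F S S′ P Q} → S ↭ S′ → Outcome F S P Q → Outcome F S′ P Q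
Outcome-resp e (full p) = full (resp e p)
Outcome-resp e (either p q) = either (λ {M} t → resp (++⁺ˡ M e) (p t)) (λ {M} t → resp (++⁺ˡ M e) (q t))
Outcome-resp e (left₁ p q) = left₁ (λ {M} t → resp (++⁺ˡ M e) (p t)) q
Outcome-resp e (right₁ p q) = right₁ (λ {M} t → resp (++⁺ˡ M e) (p t)) q
Outcome-resp e (both p) = both (λ {M} t → resp (++⁺ˡ M e) (p t))
Outcome-resp e (left₂ p q) = left₂ (resp (prep _ e) p) q
Outcome-resp e (right₂ p q) = right₂ (resp (prep _ e) p) q

-- M is an arbitrary set of further cells, as in the definition of Lacks₁. Rearrangements of the pieces are decided by
-- normalising expressions over the commutative monoid of multisets.
module Assembly (F : Map) (sq : Squares F) (SL SU SR M : List Cell) where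

  ρ : Vec (List Cell) 14
  ρ = [ F 0ℤ 0ℤ ] ∷ [ F 1ℤ 0ℤ ] ∷ [ F 0ℤ 1ℤ ] ∷ [ F 1ℤ 1ℤ ] ∷ [ F 0ℤ -1ℤ ]
    ∷ [ F -1ℤ 0ℤ ] ∷ [ F -1ℤ 1ℤ ] ∷ [ F 0ℤ 2ℤ ] ∷ [ F 1ℤ 2ℤ ] ∷ [ F 2ℤ 1ℤ ]
    ∷ SL ∷ SU ∷ SR ∷ M ∷ []

  -- The names of single cells: b(ottom) or t(op), l(eft) or r(ight) in the square of the node, and then
  -- cells of the p(arent), l(eft), u(pper) and r(ight) neighbour.
  bl br tl tr pl lb lt ul ur rt L U R m node : Expr 14
  bl = var (# 0)
  br = var (# 1)
  tl = var (# 2)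
  tr = var (# 3)
  pl = var (# 4)
  lb = var (# 5)
  lt = var (# 6)
  ul = var (# 7)
  ur = var (# 8)
  rt = var (# 9)
  L  = var (# 10)
  U  = var (# 11)
  R  = var (# 12)
  m  = var (# 13)
  node = bl ⊕ br ⊕ tl ⊕ tr ⊕ L ⊕ U ⊕ R

  -- A record type, so that the expression `e` can be inferred; the evaluated list alone does not
  -- determine it.
  record Covered (e : Expr 14) : Set where
    constructor ⟨_⟩
    field tiled : Tiled (⟦ e ⟧ ρ)
  open Covered public

  infixr 5 _∙_
  _∙_ : ∀ {e f} → Covered e → Covered f → Covered (e ⊕ f)
  ⟨ p ⟩ ∙ ⟨ q ⟩ = ⟨ p ++ᵗ q ⟩

  rearrange : ∀ {e f} {_ : True (normalise e ≟ normalise f)} → Covered e → Covered f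
  rearrange {e} {f} {ok} ⟨ p ⟩ = ⟨ resp (↭-trans (↭-sym (normalise-correct e ρ))
    (↭-trans (↭-reflexive (cong (λ v → ⟦ v ⟧⇓ ρ) (toWitness ok))) (normalise-correct f ρ))) p ⟩

  inside-bl : Covered (br ⊕ tl ⊕ tr)
  inside-bl = ⟨ omit₁ (sq 0ℤ 0ℤ) ⟩

  inside-br : Covered (bl ⊕ tl ⊕ tr)
  inside-br = ⟨ omit₂ (sq 0ℤ 0ℤ) ⟩

  inside-tl : Covered (bl ⊕ br ⊕ tr)
  inside-tl = ⟨ omit₃ (sq 0ℤ 0ℤ) ⟩

  inside-tr : Covered (bl ⊕ br ⊕ tl)
  inside-tr = ⟨ omit₄ (sq 0ℤ 0ℤ) ⟩

  corner-lu : Covered (lt ⊕ tl ⊕ ul)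
  corner-lu = ⟨ omit₃ (sq -1ℤ 1ℤ) ⟩

  corner-ur : Covered (tr ⊕ rt ⊕ ur)
  corner-ur = ⟨ omit₄ (sq 1ℤ 1ℤ) ⟩

  corner-ld : Covered (pl ⊕ lb ⊕ bl)
  corner-ld = ⟨ omit₁ (sq -1ℤ -1ℤ) ⟩

  -- The cells of `e` play the role of `M` in `Lacks₁`.
  via-lb : ∀ {e} → Lacks₁ (F -1ℤ 0ℤ) SL → Covered (lb ⊕ e) → Covered (e ⊕ L)
  via-lb {e} f ⟨ p ⟩ = ⟨ f {⟦ e ⟧ ρ} p ⟩

  via-lt : ∀ {e} → Lacks₁ (F -1ℤ 1ℤ) SL → Covered (lt ⊕ e) → Covered (e ⊕ L)
  via-lt {e} f ⟨ p ⟩ = ⟨ f {⟦ e ⟧ ρ} p ⟩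

  via-ul : ∀ {e} → Lacks₁ (F 0ℤ 2ℤ) SU → Covered (ul ⊕ e) → Covered (e ⊕ U)
  via-ul {e} f ⟨ p ⟩ = ⟨ f {⟦ e ⟧ ρ} p ⟩

  via-ur : ∀ {e} → Lacks₁ (F 1ℤ 2ℤ) SU → Covered (ur ⊕ e) → Covered (e ⊕ U)
  via-ur {e} f ⟨ p ⟩ = ⟨ f {⟦ e ⟧ ρ} p ⟩

  via-rt : ∀ {e} → Lacks₁ (F 2ℤ 1ℤ) SR → Covered (rt ⊕ e) → Covered (e ⊕ R)
  via-rt {e} f ⟨ p ⟩ = ⟨ f {⟦ e ⟧ ρ} p ⟩

  via-ul-ur : ∀ {e} → Lacks₂ (F 0ℤ 2ℤ) (F 1ℤ 2ℤ) SU → Covered (ul ⊕ ur ⊕ e) → Covered (e ⊕ U)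
  via-ul-ur {e} f ⟨ p ⟩ = ⟨ f {⟦ e ⟧ ρ} p ⟩

  -- One tromino around the top left corner of the node fills the gaps of both branches and takes
  -- `tl`.
  join-lu : Lacks₁ (F -1ℤ 1ℤ) SL → Lacks₁ (F 0ℤ 2ℤ) SU → Covered ((tl ⊕ L) ⊕ U)
  join-lu f g = via-ul {tl ⊕ L} g (rearrange (via-lt f corner-lu))

  join-ur : Lacks₁ (F 1ℤ 2ℤ) SU → Lacks₁ (F 2ℤ 1ℤ) SR → Covered ((tr ⊕ R) ⊕ U)
  join-ur f g = via-ur {tr ⊕ R} f (rearrange (via-rt {tr ⊕ ur} g (rearrange corner-ur)))

  join-lur : Lacks₁ (F -1ℤ 1ℤ) SL → Lacks₂ (F 0ℤ 2ℤ) (F 1ℤ 2ℤ) SU → Lacks₁ (F 2ℤ 1ℤ) SR →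
             Covered ((tl ⊕ L ⊕ tr ⊕ R) ⊕ U)
  join-lur f g h = via-ul-ur {tl ⊕ L ⊕ tr ⊕ R} g
    (rearrange (via-lt f corner-lu ∙ via-rt {tr ⊕ ur} h (rearrange corner-ur)))

  done : ∀ {e} {_ : True (normalise e ≟ normalise node)} → Covered e → Tiled (nodeCells F SL SU SR)
  done {e} {ok} c = tiled (rearrange {e} {node} {ok} c)

  done-m : ∀ {e} {_ : True (normalise e ≟ normalise (m ⊕ node))} → Covered e → Tiled (M ++ nodeCells F SL SU SR)
  done-m {e} {ok} c = tiled (rearrange {e} {m ⊕ node} {ok} c)

  done-pl : ∀ {e} {_ : True (normalise e ≟ normalise (pl ⊕ node))} → Covered e →
            Tiled (F 0ℤ -1ℤ ∷ nodeCells F SL SU SR)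
  done-pl {e} {ok} c = tiled (rearrange {e} {pl ⊕ node} {ok} c)

  -- The digits are the classes mod 3 of the numbers of cells in the left, upper and right branches.

  node₀₀₀ˡ : Covered L → Covered U → Covered R → Covered (bl ⊕ m) →
           Tiled (M ++ nodeCells F SL SU SR)
  node₀₀₀ˡ l u r p = done-m (inside-bl ∙ l ∙ u ∙ r ∙ p)

  node₀₀₀ʳ : Covered L → Covered U → Covered R → Covered (br ⊕ m) →
           Tiled (M ++ nodeCells F SL SU SR)
  node₀₀₀ʳ l u r p = done-m (inside-br ∙ l ∙ u ∙ r ∙ p)

  node₀₁₀ : Covered L → Covered (tl ⊕ tr ⊕ U) → Covered R → Covered (bl ⊕ br ⊕ m) →
           Tiled (M ++ nodeCells F SL SU SR)
  node₀₁₀ l u r p = done-m (l ∙ u ∙ r ∙ p)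

  node₀₂₀ˡ : Covered L → Covered (tl ⊕ U) → Covered R → Tiled (nodeCells F SL SU SR)
  node₀₂₀ˡ l u r = done (inside-tl ∙ l ∙ u ∙ r)

  node₀₂₀ʳ : Covered L → Covered (tr ⊕ U) → Covered R → Tiled (nodeCells F SL SU SR)
  node₀₂₀ʳ l u r = done (inside-tr ∙ l ∙ u ∙ r)

  node₁₀₀ : Lacks₁ (F -1ℤ 0ℤ) SL → Covered U → Covered R → Tiled (F 0ℤ -1ℤ ∷ nodeCells F SL SU SR)
  -- The tromino around the bottom left corner reaches into the parent, which leads to the outcome
  -- `left₂`.
  node₁₀₀ l u r = done-pl (via-lb {pl ⊕ bl} l (rearrange corner-ld) ∙ inside-bl ∙ u ∙ r)

  node₁₁₀ : Lacks₁ (F -1ℤ 1ℤ) SL → Lacks₁ (F 0ℤ 2ℤ) SU → Covered R → Tiled (nodeCells F SL SU SR)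
  node₁₁₀ l u r = done (join-lu l u ∙ inside-tl ∙ r)

  node₁₂₀ : Covered (bl ⊕ tl ⊕ L) → Covered (tr ⊕ U) → Covered R → Covered (br ⊕ m) →
           Tiled (M ++ nodeCells F SL SU SR)
  node₁₂₀ l u r p = done-m (l ∙ u ∙ r ∙ p)

  node₁₀₁ : Covered (bl ⊕ tl ⊕ L) → Covered U → Covered (br ⊕ tr ⊕ R) → Tiled (nodeCells F SL SU SR)
  node₁₀₁ l u r = done (l ∙ u ∙ r)

  node₁₁₁ : Lacks₁ (F -1ℤ 1ℤ) SL → Lacks₁ (F 0ℤ 2ℤ) SU → Covered (br ⊕ tr ⊕ R) → Covered (bl ⊕ m) →
           Tiled (M ++ nodeCells F SL SU SR)
  node₁₁₁ l u r p = done-m (join-lu l u ∙ r ∙ p)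

  node₁₂₁ : Lacks₁ (F -1ℤ 1ℤ) SL → Lacks₂ (F 0ℤ 2ℤ) (F 1ℤ 2ℤ) SU → Lacks₁ (F 2ℤ 1ℤ) SR → Covered (bl ⊕ br ⊕ m) →
           Tiled (M ++ nodeCells F SL SU SR)
  node₁₂₁ l u r p = done-m (join-lur l u r ∙ p)

  node₂₀₀ : Covered (tl ⊕ L) → Covered U → Covered R → Tiled (nodeCells F SL SU SR)
  node₂₀₀ l u r = done (inside-tl ∙ l ∙ u ∙ r)

  node₂₁₀ : Covered (bl ⊕ L) → Covered (tl ⊕ tr ⊕ U) → Covered R → Covered (br ⊕ m) →
           Tiled (M ++ nodeCells F SL SU SR)
  node₂₁₀ l u r p = done-m (l ∙ u ∙ r ∙ p)

  node₂₂₀ : Covered (tl ⊕ L) → Covered (tr ⊕ U) → Covered R → Covered (bl ⊕ br ⊕ m) →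
           Tiled (M ++ nodeCells F SL SU SR)
  node₂₂₀ l u r p = done-m (l ∙ u ∙ r ∙ p)

  node₂₀₁ : Covered (tl ⊕ L) → Covered U → Covered (br ⊕ tr ⊕ R) → Covered (bl ⊕ m) →
           Tiled (M ++ nodeCells F SL SU SR)
  node₂₀₁ l u r p = done-m (l ∙ u ∙ r ∙ p)

  node₂₁₁ : Covered (tl ⊕ L) → Lacks₁ (F 1ℤ 2ℤ) SU → Lacks₁ (F 2ℤ 1ℤ) SR → Covered (bl ⊕ br ⊕ m) →
           Tiled (M ++ nodeCells F SL SU SR)
  node₂₁₁ l u r p = done-m (l ∙ join-ur u r ∙ p)

  node₂₂₁ : Covered (bl ⊕ L) → Covered (tl ⊕ U) → Covered (br ⊕ tr ⊕ R) → Tiled (nodeCells F SL SU SR)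
  node₂₂₁ l u r = done (l ∙ u ∙ r)

  node₂₀₂ : Covered (tl ⊕ L) → Covered U → Covered (tr ⊕ R) → Covered (bl ⊕ br ⊕ m) →
           Tiled (M ++ nodeCells F SL SU SR)
  node₂₀₂ l u r p = done-m (l ∙ u ∙ r ∙ p)

  node₂₁₂ : Covered (bl ⊕ L) → Covered (tl ⊕ tr ⊕ U) → Covered (br ⊕ R) → Tiled (nodeCells F SL SU SR)
  node₂₁₂ l u r = done (l ∙ u ∙ r)

  node₂₂₂ : Covered (tl ⊕ L) → Covered (tr ⊕ U) → Covered (br ⊕ R) → Covered (bl ⊕ m) →
           Tiled (M ++ nodeCells F SL SU SR)
  node₂₂₂ l u r p = done-m (l ∙ u ∙ r ∙ p)

open Assembly using (⟨_⟩)

-- The number of coarse cells of the branch mod 3.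
rank : ∀ {F S P Q} → Side F S P Q → ℕ
rank (side₀ _) = 0
rank (side₁ _ _ _ _) = 1
rank (side₂ _ _ _) = 2

-- `flip (flip F)` computes to `F` only at literal coordinates, hence constructor by constructor.
flip-Side : ∀ {F S P Q} → Side F S P Q → Side (flip (flip F)) S P Q
flip-Side (side₀ p) = side₀ p
flip-Side (side₁ p q r s) = side₁ p q r s
flip-Side (side₂ p q r) = side₂ p q r

rank-flip : ∀ {F S P Q} (s : Side F S P Q) → rank (flip-Side s) ≡ rank s
rank-flip (side₀ _) = refl
rank-flip (side₁ _ _ _ _) = refl
rank-flip (side₂ _ _ _) = refl

-- By reflection, one may assume rank r ≤ rank l.
module _ {SL SU SR : List Cell} {OnLeft Above OnRight : Set} (F : Map) (sq : Squares F) where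

  private
    module N (M : List Cell) = Assembly F sq SL SU SR M

  -- The total is one more than the sum of the three digits. Mod 3 it decides the kind of outcome:
  -- `full` for 0; `either`, `left₁` or `right₁` for 1; `both`, `left₂` or `right₂` for 2.
  outcome-≤ : (l : Side F SL Above OnLeft) → Top F SU OnLeft Above OnRight → (r : Side (flip F) SR Above OnRight) →
         rank r ℕ.≤ rank l → Outcome F (nodeCells F SL SU SR) OnLeft OnRight
  outcome-≤ (side₀ l) (top₀ u) (side₀ r) _ = either
    (λ {M} p → N.node₀₀₀ˡ M ⟨ l ⟩ ⟨ u ⟩ ⟨ r ⟩ ⟨ p ⟩)
    (λ {M} p → N.node₀₀₀ʳ M ⟨ l ⟩ ⟨ u ⟩ ⟨ r ⟩ ⟨ p ⟩)
  outcome-≤ (side₀ l) (top₁ u _ _ _) (side₀ r) _ =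
    both (λ {M} p → N.node₀₁₀ M ⟨ l ⟩ ⟨ u ⟩ ⟨ r ⟩ ⟨ p ⟩)
  outcome-≤ (side₀ l) (top₂ (inj₁ u) _ _ _ _) (side₀ r) _ =
    full (N.node₀₂₀ˡ [] ⟨ l ⟩ ⟨ u ⟩ ⟨ r ⟩)
  outcome-≤ (side₀ l) (top₂ (inj₂ u) _ _ _ _) (side₀ r) _ =
    full (N.node₀₂₀ʳ [] ⟨ l ⟩ ⟨ u ⟩ ⟨ r ⟩)
  outcome-≤ (side₁ _ l _ L) (top₀ u) (side₀ r) _ =
    left₂ (N.node₁₀₀ [] l ⟨ u ⟩ ⟨ r ⟩) L
  outcome-≤ (side₁ _ _ l L) (top₁ _ u _ U) (side₀ r) _ =
    full (N.node₁₁₀ [] (l U) (u L) ⟨ r ⟩)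
  outcome-≤ (side₁ l _ _ L) (top₂ _ _ u _ _) (side₀ r) _ =
    right₁ (λ {M} p → N.node₁₂₀ M ⟨ l ⟩ ⟨ u L ⟩ ⟨ r ⟩ ⟨ p ⟩) L
  outcome-≤ (side₁ l _ _ _) (top₀ u) (side₁ r _ _ _) _ =
    full (N.node₁₀₁ [] ⟨ l ⟩ ⟨ u ⟩ ⟨ r ⟩)
  outcome-≤ (side₁ _ _ l L) (top₁ _ u _ U) (side₁ r _ _ R) _ =
    left₁ (λ {M} p → N.node₁₁₁ M (l U) (u L) ⟨ r ⟩ ⟨ p ⟩) R
  outcome-≤ (side₁ _ _ l L) (top₂ _ _ _ u U) (side₁ _ _ r R) _ =
    both (λ {M} p → N.node₁₂₁ M (l U) (u L R) (r U) ⟨ p ⟩)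
  outcome-≤ (side₂ l _ _) (top₀ u) (side₀ r) _ =
    full (N.node₂₀₀ [] ⟨ l ⟩ ⟨ u ⟩ ⟨ r ⟩)
  outcome-≤ (side₂ _ l L) (top₁ u _ _ U) (side₀ r) _ =
    right₁ (λ {M} p → N.node₂₁₀ M ⟨ l U ⟩ ⟨ u ⟩ ⟨ r ⟩ ⟨ p ⟩) L
  outcome-≤ (side₂ l _ L) (top₂ _ _ u _ _) (side₀ r) _ =
    both (λ {M} p → N.node₂₂₀ M ⟨ l ⟩ ⟨ u L ⟩ ⟨ r ⟩ ⟨ p ⟩)
  outcome-≤ (side₂ l _ _) (top₀ u) (side₁ r _ _ R) _ =
    left₁ (λ {M} p → N.node₂₀₁ M ⟨ l ⟩ ⟨ u ⟩ ⟨ r ⟩ ⟨ p ⟩) R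
  outcome-≤ (side₂ l _ _) (top₁ _ _ u U) (side₁ _ _ r R) _ =
    both (λ {M} p → N.node₂₁₁ M ⟨ l ⟩ (u R) (r U) ⟨ p ⟩)
  outcome-≤ (side₂ _ l _) (top₂ _ u _ _ U) (side₁ r _ _ R) _ =
    full (N.node₂₂₁ [] ⟨ l U ⟩ ⟨ u R ⟩ ⟨ r ⟩)
  outcome-≤ (side₂ l _ _) (top₀ u) (side₂ r _ _) _ =
    both (λ {M} p → N.node₂₀₂ M ⟨ l ⟩ ⟨ u ⟩ ⟨ r ⟩ ⟨ p ⟩)
  outcome-≤ (side₂ _ l _) (top₁ u _ _ U) (side₂ _ r _) _ =
    full (N.node₂₁₂ [] ⟨ l U ⟩ ⟨ u ⟩ ⟨ r U ⟩)
  outcome-≤ (side₂ l _ L) (top₂ _ _ u _ U) (side₂ _ r R) _ =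
    left₁ (λ {M} p → N.node₂₂₂ M ⟨ l ⟩ ⟨ u L ⟩ ⟨ r U ⟩ ⟨ p ⟩) R
  outcome-≤ (side₀ _) _ (side₁ _ _ _ _) ()
  outcome-≤ (side₀ _) _ (side₂ _ _ _) ()
  outcome-≤ (side₁ _ _ _ _) _ (side₂ _ _ _) (ℕ.s≤s ())

outcome : ∀ {SL SU SR OnLeft Above OnRight} F → Squares F →
          Side F SL Above OnLeft → Top F SU OnLeft Above OnRight → Side (flip F) SR Above OnRight →
          Outcome F (nodeCells F SL SU SR) OnLeft OnRight
outcome {SL} {SU} {SR} F sq l u r with ℕ.≤-total (rank r) (rank l)
... | inj₁ r≤l = outcome-≤ F sq l u r r≤l
... | inj₂ l≤r = Outcome-resp
  (solve 7 (λ bl br tl tr L U R → (br ⊕ bl ⊕ tr ⊕ tl ⊕ R ⊕ U ⊕ L) ⊜ (bl ⊕ br ⊕ tl ⊕ tr ⊕ L ⊕ U ⊕ R)) ↭-refl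
    [ F 0ℤ 0ℤ ] [ F 1ℤ 0ℤ ] [ F 0ℤ 1ℤ ] [ F 1ℤ 1ℤ ] SL SU SR)
  (unflip-Outcome (outcome-≤ (flip F) (reflect-Squares 1ℤ F sq) r (flip-Top u) (flip-Side l)
    (subst (ℕ._≤ rank r) (sym (rank-flip l)) l≤r)))

-- Frames: coordinates adapted to a node

double : Cell → Cell
double (i , j) = + 2 * i , + 2 * j

Neighbours : Map → Set
Neighbours G = ∀ a b {x} → Adjacent (G a b) x →
               x ∈ G (a - 1ℤ) b ∷ G (a + 1ℤ) b ∷ G a (b - 1ℤ) ∷ G a (b + 1ℤ) ∷ []

reflect-Neighbours : ∀ k G → Neighbours G → Neighbours (reflect k G)
reflect-Neighbours k G nb a b {x} ad =
  ∈-resp-↭ (swap _ _ ↭-refl)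
    (subst₂ (λ c d → x ∈ G c b ∷ G d b ∷ G (k - a) (b - 1ℤ) ∷ G (k - a) (b + 1ℤ) ∷ [])
      (eq₁ k a) (eq₂ k a) (nb (k - a) b ad))
  where
  eq₁ : ∀ k a → (k - a) - 1ℤ ≡ k - (a + 1ℤ)
  eq₁ = solve-∀
  eq₂ : ∀ k a → (k - a) + 1ℤ ≡ k - (a - 1ℤ)
  eq₂ = solve-∀

rotate-Neighbours : ∀ G → Neighbours G → Neighbours (rotate G)
rotate-Neighbours G nb a b {x} ad =
  ∈-resp-↭ (solve 4 (λ p q r s → (p ⊕ q ⊕ r ⊕ s) ⊜ (r ⊕ s ⊕ q ⊕ p)) ↭-refl
      [ G (-1ℤ - (b + 1ℤ)) a ] [ G (-1ℤ - (b - 1ℤ)) a ] [ G (-1ℤ - b) (a - 1ℤ) ] [ G (-1ℤ - b) (a + 1ℤ) ])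
    (subst₂ (λ c d → x ∈ G c a ∷ G d a ∷ G (-1ℤ - b) (a - 1ℤ) ∷ G (-1ℤ - b) (a + 1ℤ) ∷ [])
      (eq₁ b) (eq₂ b) (nb (-1ℤ - b) a ad))
  where
  eq₁ : ∀ a → (-1ℤ - a) - 1ℤ ≡ -1ℤ - (a + 1ℤ)
  eq₁ = solve-∀
  eq₂ : ∀ a → (-1ℤ - a) + 1ℤ ≡ -1ℤ - (a - 1ℤ)
  eq₂ = solve-∀

raise-Neighbours : ∀ k G → Neighbours G → Neighbours (raise k G)
raise-Neighbours k G nb a b {x} ad =
  subst₂ (λ c d → x ∈ G (a - 1ℤ) (b + k) ∷ G (a + 1ℤ) (b + k) ∷ G a c ∷ G a d ∷ [])
    (eq₁ b k) (eq₂ b k) (nb a (b + k) ad)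
  where
  eq₁ : ∀ b k → (b + k) - 1ℤ ≡ (b - 1ℤ) + k
  eq₁ = solve-∀
  eq₂ : ∀ b k → (b + k) + 1ℤ ≡ (b + 1ℤ) + k
  eq₂ = solve-∀

quad : Map → ℤ → ℤ → ℤ → ℤ → List Cell
quad F a a′ b b′ = F a b ∷ F a′ b ∷ F a b′ ∷ F a′ b′ ∷ []

-- Only up to order, since reflections and rotations permute the four fine cells of a coarse cell.
Refines : Map → Map → Set
Refines F G = ∀ a b → quad F (2ℤ * a) (2ℤ * a + 1ℤ) (2ℤ * b) (2ℤ * b + 1ℤ) ↭ block (double (G a b))

flip-Refines : ∀ F G → Refines F G → Refines (flip F) (reflect 0ℤ G)
flip-Refines F G rf a b = ↭-trans (swap _ _ (swap _ _ ↭-refl))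
  (subst₂ (λ c d → quad F c d (2ℤ * b) (2ℤ * b + 1ℤ) ↭ block (double (G (0ℤ - a) b)))
    (eq₁ a) (eq₂ a) (rf (0ℤ - a) b))
  where
  eq₁ : ∀ a → 2ℤ * (0ℤ - a) ≡ 1ℤ - (2ℤ * a + 1ℤ)
  eq₁ = solve-∀
  eq₂ : ∀ a → 2ℤ * (0ℤ - a) + 1ℤ ≡ 1ℤ - 2ℤ * a
  eq₂ = solve-∀

rotate-Refines : ∀ F G → Refines F G → Refines (rotate F) (rotate G)
rotate-Refines F G rf a b = ↭-trans
  (solve 4 (λ p q r s → (q ⊕ s ⊕ p ⊕ r) ⊜ (p ⊕ q ⊕ r ⊕ s)) ↭-refl
    [ F b′ (2ℤ * a) ] [ F b″ (2ℤ * a) ] [ F b′ (2ℤ * a + 1ℤ) ] [ F b″ (2ℤ * a + 1ℤ) ])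
  (subst₂ (λ c d → quad F c d (2ℤ * a) (2ℤ * a + 1ℤ) ↭ block (double (G (-1ℤ - b) a)))
    (eq₁ b) (eq₂ b) (rf (-1ℤ - b) a))
  where
  b′ = -1ℤ - (2ℤ * b + 1ℤ)
  b″ = -1ℤ - 2ℤ * b
  eq₁ : ∀ b → 2ℤ * (-1ℤ - b) ≡ -1ℤ - (2ℤ * b + 1ℤ)
  eq₁ = solve-∀
  eq₂ : ∀ b → 2ℤ * (-1ℤ - b) + 1ℤ ≡ -1ℤ - 2ℤ * b
  eq₂ = solve-∀

raise-Refines : ∀ F G → Refines F G → Refines (raise 2ℤ F) (raise 1ℤ G)
raise-Refines F G rf a b =
  subst₂ (λ c d → quad F (2ℤ * a) (2ℤ * a + 1ℤ) c d ↭ block (double (G a (b + 1ℤ))))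
    (eq₁ b) (eq₂ b) (rf a (b + 1ℤ))
  where
  eq₁ : ∀ b → 2ℤ * (b + 1ℤ) ≡ 2ℤ * b + 2ℤ
  eq₁ = solve-∀
  eq₂ : ∀ b → 2ℤ * (b + 1ℤ) + 1ℤ ≡ 2ℤ * b + 1ℤ + 2ℤ
  eq₂ = solve-∀

record Frame : Set where
  field
    coarse fine : Map
    coarse-squares : Squares coarse
    fine-squares   : Squares fine
    neighbours     : Neighbours coarse
    refines        : Refines fine coarse
open Frame

flipᶠ leftᶠ upᶠ rightᶠ : Frame → Frame
flipᶠ f = record
  { coarse         = reflect 0ℤ (coarse f)
  ; fine           = flip (fine f)
  ; coarse-squares = reflect-Squares 0ℤ (coarse f) (coarse-squares f)
  ; fine-squares   = reflect-Squares 1ℤ (fine f) (fine-squares f)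
  ; neighbours     = reflect-Neighbours 0ℤ (coarse f) (neighbours f)
  ; refines        = flip-Refines (fine f) (coarse f) (refines f)
  }
leftᶠ f = record
  { coarse         = rotate (coarse f)
  ; fine           = rotate (fine f)
  ; coarse-squares = rotate-Squares (coarse f) (coarse-squares f)
  ; fine-squares   = rotate-Squares (fine f) (fine-squares f)
  ; neighbours     = rotate-Neighbours (coarse f) (neighbours f)
  ; refines        = rotate-Refines (fine f) (coarse f) (refines f)
  }
upᶠ f = record
  { coarse         = raise 1ℤ (coarse f)
  ; fine           = raise 2ℤ (fine f)
  ; coarse-squares = raise-Squares 1ℤ (coarse f) (coarse-squares f)
  ; fine-squares   = raise-Squares 2ℤ (fine f) (fine-squares f)
  ; neighbours     = raise-Neighbours 1ℤ (coarse f) (neighbours f)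
  ; refines        = raise-Refines (fine f) (coarse f) (refines f)
  }
-- A right child is the left child of the mirrored node; thus in the frame of either side child,
-- left points down and right points up.
rightᶠ f = leftᶠ (flipᶠ f)

translate : Cell → Map
translate (i , j) a b = i + a , j + b

translate-Squares : ∀ c → Squares (translate c)
translate-Squares (i , j) a b = (i + a , j + b) ,
  subst₂ (λ k l → (i + a , j + b) ∷ (k , j + b) ∷ (i + a , l) ∷ (k , l) ∷ [] ↭ block (i + a , j + b))
    (ℤ.+-assoc i a 1ℤ) (ℤ.+-assoc j b 1ℤ) (prep _ (swap _ _ ↭-refl))

+≡1 : ∀ m n → m ℕ.+ n ≡ 1 → (m ≡ 0 × n ≡ 1) ⊎ (m ≡ 1 × n ≡ 0)
+≡1 0 n e = inj₁ (refl , e)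
+≡1 1 0 e = inj₂ (refl , refl)

∣i-j∣≡0 : ∀ i j → ∣ i - j ∣ ≡ 0 → j ≡ i
∣i-j∣≡0 i j e with i - j in eq
∣i-j∣≡0 i j e | + 0 = trans (law i j) (trans (cong (λ d → i - d) eq) (law₀ i))
  where
  law : ∀ i j → j ≡ i - (i - j)
  law = solve-∀
  law₀ : ∀ i → i - 0ℤ ≡ i
  law₀ = solve-∀

∣i-j∣≡1 : ∀ i j → ∣ i - j ∣ ≡ 1 → j ≡ i - 1ℤ ⊎ j ≡ i + 1ℤ
∣i-j∣≡1 i j e with i - j in eq
... | + 1 = inj₁ (trans (law i j) (cong (λ d → i - d) eq))
  where
  law : ∀ i j → j ≡ i - (i - j)
  law = solve-∀
... | -[1+ 0 ] = inj₂ (trans (law i j) (cong (λ d → i - d) eq))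
  where
  law : ∀ i j → j ≡ i - (i - j)
  law = solve-∀

translate-Neighbours : ∀ c → Neighbours (translate c)
translate-Neighbours (i , j) a b {k , l} ad with +≡1 ∣ (i + a) - k ∣ ∣ (j + b) - l ∣ ad
... | inj₁ (p , q) with ∣i-j∣≡1 (j + b) l q
...   | inj₁ e = there (there (here (cong₂ _,_ (∣i-j∣≡0 _ k p) (trans e (ℤ.+-assoc j b -1ℤ)))))
...   | inj₂ e = there (there (there (here (cong₂ _,_ (∣i-j∣≡0 _ k p) (trans e (ℤ.+-assoc j b 1ℤ))))))
translate-Neighbours (i , j) a b {k , l} ad | inj₂ (p , q) with ∣i-j∣≡1 (i + a) k p
...   | inj₁ e = here (cong₂ _,_ (trans e (ℤ.+-assoc i a -1ℤ)) (∣i-j∣≡0 _ l q))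
...   | inj₂ e = there (here (cong₂ _,_ (trans e (ℤ.+-assoc i a 1ℤ)) (∣i-j∣≡0 _ l q)))

translate-Refines : ∀ c → Refines (translate (double c)) (translate c)
translate-Refines (i , j) a b =
  subst₂ (λ k l → quad (translate (double (i , j))) (2ℤ * a) (2ℤ * a + 1ℤ) (2ℤ * b) (2ℤ * b + 1ℤ) ↭ block (k , l))
    (eq i a) (eq j b)
    (subst₂ (λ k l → (i′ , j′) ∷ (k , j′) ∷ (i′ , l) ∷ (k , l) ∷ [] ↭ block (i′ , j′))
      (eq₁ i a) (eq₁ j b) (prep _ (swap _ _ ↭-refl)))
  where
  i′ = + 2 * i + 2ℤ * a
  j′ = + 2 * j + 2ℤ * b
  eq : ∀ i a → + 2 * i + 2ℤ * a ≡ + 2 * (i + a)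
  eq = solve-∀
  eq₁ : ∀ i a → + 2 * i + 2ℤ * a + 1ℤ ≡ + 2 * i + (2ℤ * a + 1ℤ)
  eq₁ = solve-∀

frameAt : Cell → Frame
frameAt c = record
  { coarse         = translate c
  ; fine           = translate (double c)
  ; coarse-squares = translate-Squares c
  ; fine-squares   = translate-Squares (double c)
  ; neighbours     = translate-Neighbours c
  ; refines        = translate-Refines c
  }

-- Spanning trees

data Tree : Set where
  nil  : Tree
  node : Tree → Tree → Tree → Tree

-- A `Tree` is only a shape: the frame of the root fixes all positions, the children lying left,
-- above and right, and the direction below being reserved for the parent.
treeCells fineCells : Frame → Tree → List Cell
treeCells f nil          = []
treeCells f (node l u r) =
  coarse f 0ℤ 0ℤ ∷ treeCells (leftᶠ f) l ++ treeCells (upᶠ f) u ++ treeCells (rightᶠ f) r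
fineCells f nil          = []
fineCells f (node l u r) =
  nodeCells (fine f) (fineCells (leftᶠ f) l) (fineCells (upᶠ f) u) (fineCells (rightᶠ f) r)

subdivide : List Cell → List Cell
subdivide = concatMap (λ c → block (double c))

subdivide-cells : ∀ f t → subdivide (treeCells f t) ↭ fineCells f t
subdivide-cells f nil = ↭-refl
subdivide-cells f (node l u r)
  rewrite concatMap-++ (block ∘ double) (treeCells (leftᶠ f) l) (treeCells (upᶠ f) u ++ treeCells (rightᶠ f) r)
        | concatMap-++ (block ∘ double) (treeCells (upᶠ f) u) (treeCells (rightᶠ f) r)
  = ++⁺ (↭-sym (refines f 0ℤ 0ℤ))
      (++⁺ (subdivide-cells (leftᶠ f) l) (++⁺ (subdivide-cells (upᶠ f) u) (subdivide-cells (rightᶠ f) r)))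

Here HasLeft HasRight : Tree → Set
Here nil          = ⊥
Here (node _ _ _) = ⊤
HasLeft nil           = ⊥
HasLeft (node l _ _)  = Here l
HasRight nil          = ⊥
HasRight (node _ _ r) = Here r

root∈ : ∀ f t → Here t → coarse f 0ℤ 0ℤ ∈ treeCells f t
root∈ f (node _ _ _) _ = here refl

left∈ : ∀ f t → HasLeft t → coarse f -1ℤ 0ℤ ∈ treeCells f t
left∈ f (node l u r) h = there (∈-++⁺ˡ (root∈ (leftᶠ f) l h))

right∈ : ∀ f t → HasRight t → coarse f 1ℤ 0ℤ ∈ treeCells f t
right∈ f (node l u r) h = there (∈-++⁺ʳ (treeCells (leftᶠ f) l) (∈-++⁺ʳ (treeCells (upᶠ f) u) (root∈ (rightᶠ f) r h)))

left⇒here : ∀ t → HasLeft t → Here t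
left⇒here (node _ _ _) _ = tt

right⇒here : ∀ t → HasRight t → Here t
right⇒here (node _ _ _) _ = tt

-- Tilings of trees in sets without blocks

NoBlock : List Cell → Set
NoBlock S = ∀ b → ¬ All (_∈ S) (block b)

module _ {S : List Cell} (noBlock : NoBlock S) where

  noSquare : ∀ {p q r s} → Square p q r s → p ∈ S → q ∈ S → r ∈ S → s ∈ S → ⊥
  noSquare (b , e) p q r s = noBlock b (All-resp-↭ e (p ∷ q ∷ r ∷ s ∷ []))

  _⊑S : List Cell → Set
  cs ⊑S = ∀ {x} → x ∈ cs → x ∈ S

  -- Translates the outcome of a left branch into the frame of its parent. A child below the left
  -- root would lie on the excluded cell `coarse f -1ℤ -1ℤ`; a child above it would complete a block
  -- with the node and its upper child.
  sideBranch : ∀ f l {Above} → treeCells (leftᶠ f) l ⊑S → coarse f 0ℤ 0ℤ ∈ S →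
               (Above → coarse f 0ℤ 1ℤ ∈ S) → (Here l → coarse f -1ℤ -1ℤ ∉ S) →
               Outcome (fine (leftᶠ f)) (fineCells (leftᶠ f) l) (HasLeft l) (HasRight l) →
               Side (fine f) (fineCells (leftᶠ f) l) Above (Here l)
  sideBranch f nil _ _ _ _ _ = side₀ []
  sideBranch f l@(node _ _ _) {Above} sub v∈ up∈ down∉ o = go o
    where
    F = fine f
    -- The fine square astride the edge between the node and its left child; all trominoes added
    -- below lie in it.
    sq = fine-squares f -1ℤ 0ℤ
    noL : ¬ HasLeft l
    noL h = down∉ tt (sub (left∈ (leftᶠ f) l h))
    noR : Above → ¬ HasRight l
    noR a h = noSquare (coarse-squares f -1ℤ 0ℤ) (sub (here refl)) v∈ (sub (right∈ (leftᶠ f) l h)) (up∈ a)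
    go : Outcome (fine (leftᶠ f)) (fineCells (leftᶠ f) l) (HasLeft l) (HasRight l) →
         Side F (fineCells (leftᶠ f) l) Above (Here l)
    go (full p)     = side₀ p
    go (either a b) = side₁ (a (omit₃ sq)) a (λ _ → b) tt
    go (left₁ a r)  = side₁ (a (omit₃ sq)) a (λ u → ⊥-elim (noR u r)) tt
    go (right₁ _ h) = ⊥-elim (noL h)
    go (both b)     = side₂ (b (omit₂ sq)) (λ _ → b (resp (prep _ (swap _ _ ↭-refl)) (omit₄ sq))) tt
    go (left₂ _ h)  = ⊥-elim (noL h)
    go (right₂ p r) = side₂ p (λ u → ⊥-elim (noR u r)) tt

  -- A child of the upper root and a child of the node on the same side would form a block with
  -- these two cells.
  topBranch : ∀ f u {OnLeft OnRight} → treeCells (upᶠ f) u ⊑S → coarse f 0ℤ 0ℤ ∈ S →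
              (OnLeft → coarse f -1ℤ 0ℤ ∈ S) → (OnRight → coarse f 1ℤ 0ℤ ∈ S) →
              Outcome (fine (upᶠ f)) (fineCells (upᶠ f) u) (HasLeft u) (HasRight u) →
              Top (fine f) (fineCells (upᶠ f) u) OnLeft (Here u) OnRight
  topBranch f nil _ _ _ _ _ = top₀ []
  topBranch f u@(node _ _ _) {OnLeft} {OnRight} sub v∈ left∈S right∈S o = go o
    where
    F = fine f
    sq = fine-squares f 0ℤ 1ℤ
    noL : OnLeft → ¬ HasLeft u
    noL a h = noSquare (coarse-squares f -1ℤ 0ℤ) (left∈S a) v∈ (sub (left∈ (upᶠ f) u h)) (sub (here refl))
    noR : OnRight → ¬ HasRight u
    noR a h = noSquare (coarse-squares f 0ℤ 0ℤ) v∈ (right∈S a) (sub (here refl)) (sub (right∈ (upᶠ f) u h))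
    ul = F 0ℤ 2ℤ
    ur = F 1ℤ 2ℤ
    row-ul : Tiled (ul ∷ F 0ℤ 1ℤ ∷ F 1ℤ 1ℤ ∷ [])
    row-ul = resp (shift ul (F 0ℤ 1ℤ ∷ F 1ℤ 1ℤ ∷ []) []) (omit₄ sq)
    row-ur : Tiled (ur ∷ F 0ℤ 1ℤ ∷ F 1ℤ 1ℤ ∷ [])
    row-ur = resp (shift ur (F 0ℤ 1ℤ ∷ F 1ℤ 1ℤ ∷ []) []) (omit₃ sq)
    row-tl : Tiled (ul ∷ ur ∷ F 0ℤ 1ℤ ∷ [])
    row-tl = resp (↭-sym (shift (F 0ℤ 1ℤ) (ul ∷ ur ∷ []) [])) (omit₂ sq)
    row-tr : Tiled (ul ∷ ur ∷ F 1ℤ 1ℤ ∷ [])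
    row-tr = resp (↭-sym (shift (F 1ℤ 1ℤ) (ul ∷ ur ∷ []) [])) (omit₁ sq)
    go : Outcome (fine (upᶠ f)) (fineCells (upᶠ f) u) (HasLeft u) (HasRight u) →
         Top F (fineCells (upᶠ f) u) OnLeft (Here u) OnRight
    go (full p)     = top₀ p
    go (either a b) = top₁ (a row-ul) (λ _ → a) (λ _ → b) tt
    go (left₁ a r)  = top₁ (a row-ul) (λ _ → a) (λ x → ⊥-elim (noR x r)) tt
    go (right₁ b l) = top₁ (b row-ur) (λ x → ⊥-elim (noL x l)) (λ _ → b) tt
    go (both b)     = top₂ (inj₁ (b row-tl)) (λ _ → b row-tl) (λ _ → b row-tr) (λ _ _ → b) tt
    go (left₂ p l)  = top₂ (inj₁ p) (λ _ → p) (λ x → ⊥-elim (noL x l)) (λ x _ → ⊥-elim (noL x l)) tt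
    go (right₂ p r) = top₂ (inj₂ p) (λ x → ⊥-elim (noR x r)) (λ _ → p) (λ _ x → ⊥-elim (noR x r)) tt

  -- Otherwise the root, its left child, the parent and the cell beside the parent form a block.
  clear-left : ∀ f t → treeCells f t ⊑S → coarse f 0ℤ -1ℤ ∈ S → HasLeft t → coarse f -1ℤ -1ℤ ∉ S
  clear-left f t sub p∈ h d∈ =
    noSquare (coarse-squares f -1ℤ -1ℤ) d∈ p∈ (sub (left∈ f t h)) (sub (root∈ f t (left⇒here t h)))

  clear-right : ∀ f t → treeCells f t ⊑S → coarse f 0ℤ -1ℤ ∈ S → HasRight t → coarse f 1ℤ -1ℤ ∉ S
  clear-right f t sub p∈ h d∈ =
    noSquare (coarse-squares f 0ℤ -1ℤ) p∈ d∈ (sub (root∈ f t (right⇒here t h))) (sub (right∈ f t h))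

  -- The two conditions keep the side children from having children below them. They hold at the
  -- root of the whole tree because it is a lowest cell, and further up the tree by `clear-left` and
  -- `clear-right`.
  treeOutcome : ∀ f t → treeCells f t ⊑S →
                (HasLeft t → coarse f -1ℤ -1ℤ ∉ S) → (HasRight t → coarse f 1ℤ -1ℤ ∉ S) →
                Outcome (fine f) (fineCells f t) (HasLeft t) (HasRight t)
  treeOutcome f nil _ _ _ = full []
  treeOutcome f (node l u r) sub cl cr =
    outcome (fine f) (fine-squares f)
      (sideBranch f l subˡ v∈ u∈ cl (branch (leftᶠ f) l subˡ v∈))
      (topBranch f u subᵘ v∈ (λ h → subˡ (root∈ (leftᶠ f) l h)) (λ h → subʳ (root∈ (rightᶠ f) r h))
        (branch (upᶠ f) u subᵘ v∈))
      (sideBranch (flipᶠ f) r subʳ v∈ u∈ cr (branch (rightᶠ f) r subʳ v∈))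
    where
    v∈ : coarse f 0ℤ 0ℤ ∈ S
    v∈ = sub (here refl)
    subˡ : treeCells (leftᶠ f) l ⊑S
    subˡ h = sub (there (∈-++⁺ˡ h))
    subᵘ : treeCells (upᶠ f) u ⊑S
    subᵘ h = sub (there (∈-++⁺ʳ (treeCells (leftᶠ f) l) (∈-++⁺ˡ h)))
    subʳ : treeCells (rightᶠ f) r ⊑S
    subʳ h = sub (there (∈-++⁺ʳ (treeCells (leftᶠ f) l) (∈-++⁺ʳ (treeCells (upᶠ f) u) h)))
    u∈ : Here u → coarse f 0ℤ 1ℤ ∈ S
    u∈ h = subᵘ (root∈ (upᶠ f) u h)
    branch : ∀ g t → treeCells g t ⊑S → coarse g 0ℤ -1ℤ ∈ S →
             Outcome (fine g) (fineCells g t) (HasLeft t) (HasRight t)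
    branch g t s p∈ = treeOutcome g t s (clear-left g t s p∈) (clear-right g t s p∈)

-- Connected sets of cells

Unique-resp-↭ : ∀ {xs ys : List Cell} → xs ↭ ys → Unique xs → Unique ys
Unique-resp-↭ e = SetoidPerm.Unique-resp-↭ (setoid Cell) (↭⇒↭ₛ e)

module _ {A : Set} where

  Unique-++⁻ : ∀ (xs : List A) {ys} → Unique (xs ++ ys) → Unique xs × Unique ys × Disjoint xs ys
  Unique-++⁻ []       u        = [] , u , λ ()
  Unique-++⁻ (x ∷ xs) (x∉ ∷ u) with Unique-++⁻ xs u
  ... | uˡ , uʳ , d = All.++⁻ˡ xs x∉ ∷ uˡ , uʳ , λ where
    (here refl , y∈) → All.lookup (All.++⁻ʳ xs x∉) y∈ refl
    (there x∈ , y∈)  → d (x∈ , y∈)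

  extract : ∀ {x : A} {S} → x ∈ S → ∃ λ S′ → x ∷ S′ ↭ S
  extract x∈S with ∈-∃++ x∈S
  ... | as , bs , refl = as ++ bs , ↭-sym (shift _ as bs)

  extracts : ∀ {T S : List A} → Unique T → All (_∈ S) T → ∃ λ S′ → T ++ S′ ↭ S
  extracts {[]} {S} _ _ = S , ↭-refl
  extracts {t ∷ T} {S} (t∉T ∷ u) (t∈S ∷ T⊆S) with extract t∈S
  ... | S₁ , e with extracts {T} {S₁} u (All.map (λ where
        (t≢x , x∈S) → Any.tail (t≢x ∘ sym) (∈-resp-↭ (↭-sym e) x∈S)) (All.zip (t∉T , T⊆S)))
  ... | S₂ , e′ = S₂ , ↭-trans (prep t e′) e

Adjacent-sym : ∀ c d → Adjacent c d → Adjacent d c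
Adjacent-sym (i , j) (k , l) e = trans (cong₂ ℕ._+_ (ℤ.∣i-j∣≡∣j-i∣ k i) (ℤ.∣i-j∣≡∣j-i∣ l j)) e

Connected : List Cell → Set
Connected S = ∀ {c d} → c ∈ S → d ∈ S → Star (AdjacentIn S) c d

widen : ∀ {A B c d} → (∀ {x} → x ∈ A → x ∈ B) → Star (AdjacentIn A) c d → Star (AdjacentIn B) c d
widen f = map (λ where (c∈ , d∈ , ad) → f c∈ , f d∈ , ad)

Connected-[_] : ∀ c → Connected [ c ]
Connected-[ c ] (here refl) (here refl) = ε

Connected-++ : ∀ {A B a b} → Connected A → Connected B → a ∈ A → b ∈ B → Adjacent a b → Connected (A ++ B)
Connected-++ {A} {B} {a} {b} conA conB a∈ b∈ ad {c} {d} c∈ d∈ = go (∈-++⁻ A c∈) (∈-++⁻ A d∈)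
  where
  inˡ : ∀ {x y} → Star (AdjacentIn A) x y → Star (AdjacentIn (A ++ B)) x y
  inˡ = widen ∈-++⁺ˡ
  inʳ : ∀ {x y} → Star (AdjacentIn B) x y → Star (AdjacentIn (A ++ B)) x y
  inʳ = widen (∈-++⁺ʳ A)
  go : c ∈ A ⊎ c ∈ B → d ∈ A ⊎ d ∈ B → Star (AdjacentIn (A ++ B)) c d
  go (inj₁ c∈) (inj₁ d∈) = inˡ (conA c∈ d∈)
  go (inj₂ c∈) (inj₂ d∈) = inʳ (conB c∈ d∈)
  go (inj₁ c∈) (inj₂ d∈) = inˡ (conA c∈ a∈) ◅◅ (∈-++⁺ˡ a∈ , ∈-++⁺ʳ A b∈ , ad) ◅ inʳ (conB b∈ d∈)
  go (inj₂ c∈) (inj₁ d∈) = inʳ (conB c∈ b∈) ◅◅ (∈-++⁺ʳ A b∈ , ∈-++⁺ˡ a∈ , Adjacent-sym a b ad) ◅ inˡ (conA a∈ d∈)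

crossing : ∀ {S} ys {c d} → Star (AdjacentIn S) c d → c ∈ ys → d ∉ ys →
           ∃₂ λ y x → y ∈ ys × x ∈ S × x ∉ ys × Adjacent y x
crossing ys ε c∈ d∉ = contradiction c∈ d∉
crossing ys (_◅_ {j = b} (_ , b∈S , ad) path) c∈ d∉ with b ∈? ys
... | yes b∈ = crossing ys path b∈ d∉
... | no  b∉ = _ , b , c∈ , b∈S , b∉ , ad

-- The cells zs of S are those not yet reached.
spread : (P : List Cell → Set) {S : List Cell} → Unique S → Connected S →
         (∀ {ys y x} → P ys → y ∈ ys → x ∈ S → x ∉ ys → Adjacent y x → P (x ∷ ys)) →
         ∀ {y ys} zs → y ∷ ys ++ zs ↭ S → P (y ∷ ys) → ∃ λ S′ → S′ ↭ S × P S′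
spread P {S} uniq con step {y} {ys} zs e p = go (length zs) zs ys refl e p
  where
  -- `n` is the number of cells not yet reached and makes the recursion structural.
  go : ∀ n zs {y} ys → length zs ≡ n → y ∷ ys ++ zs ↭ S → P (y ∷ ys) → ∃ λ S′ → S′ ↭ S × P S′
  go _ [] {y} ys _ e p = y ∷ ys , subst (λ l → y ∷ l ↭ S) (++-identityʳ ys) e , p
  go (ℕ.suc n) (z ∷ zs) {y} ys len e p
    -- A path from `y` to the unreached cell `z` must leave the reached cells along some edge, here
    -- from `w` to `x`.
    with crossing (y ∷ ys) (con (∈-resp-↭ e (here refl)) (∈-resp-↭ e (∈-++⁺ʳ (y ∷ ys) (here refl)))) (here refl)
           (λ z∈ → proj₂ (proj₂ (Unique-++⁻ (y ∷ ys) (Unique-resp-↭ (↭-sym e) uniq))) (z∈ , here refl))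
  ... | w , x , w∈ , x∈S , x∉ , ad with ∈-++⁻ (y ∷ ys) (∈-resp-↭ (↭-sym e) x∈S)
  ...   | inj₁ x∈ = contradiction x∈ x∉
  ...   | inj₂ x∈zs with extract x∈zs
  ...     | zs′ , e′ = go n zs′ (y ∷ ys) (ℕ.suc-injective (trans (↭-length e′) len))
              (↭-trans (↭-sym (shift x (y ∷ ys) zs′)) (↭-trans (++⁺ˡ (y ∷ ys) e′) e)) (step p w∈ x∈S x∉ ad)

-- Growing the spanning tree

sprout : ∀ f t → coarse f 0ℤ 0ℤ ∉ treeCells f t → ∃ λ t′ → treeCells f t′ ↭ coarse f 0ℤ 0ℤ ∷ treeCells f t
sprout f nil          _ = node nil nil nil , ↭-refl
sprout f (node _ _ _) h = contradiction (here refl) h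

module _ (f : Frame) (l u r : Tree) {x : Cell} where

  private
    v = coarse f 0ℤ 0ℤ
    L = treeCells (leftᶠ f) l
    U = treeCells (upᶠ f) u
    R = treeCells (rightᶠ f) r

  Extension : Frame → Tree → Set
  Extension g t = ∃ λ t′ → treeCells g t′ ↭ x ∷ treeCells g t

  extend-left : Extension (leftᶠ f) l → Extension f (node l u r)
  extend-left (l′ , e) = node l′ u r , ↭-trans (prep v (++⁺ʳ (U ++ R) e)) (swap v x ↭-refl)

  extend-up : Extension (upᶠ f) u → Extension f (node l u r)
  extend-up (u′ , e) = node l u′ r , ↭-trans (prep v (++⁺ˡ L (++⁺ʳ R e))) (shift x (v ∷ L) (U ++ R))

  extend-right : Extension (rightᶠ f) r → Extension f (node l u r)
  extend-right (r′ , e) = node l u r′ ,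
    ↭-trans (prep v (++⁺ˡ L (++⁺ˡ U e)))
      (solve 5 (λ v x L U R → (v ⊕ L ⊕ U ⊕ x ⊕ R) ⊜ (x ⊕ v ⊕ L ⊕ U ⊕ R)) ↭-refl [ v ] [ x ] L U R)

  ∉-left : x ∉ treeCells f (node l u r) → x ∉ L
  ∉-left h x∈ = h (there (∈-++⁺ˡ x∈))

  ∉-up : x ∉ treeCells f (node l u r) → x ∉ U
  ∉-up h x∈ = h (there (∈-++⁺ʳ L (∈-++⁺ˡ x∈)))

  ∉-right : x ∉ treeCells f (node l u r) → x ∉ R
  ∉-right h x∈ = h (there (∈-++⁺ʳ L (∈-++⁺ʳ U x∈)))

-- The new cell becomes a leaf at `y`. Three of the directions from `y` are places for children,
-- vacant if `x` lies there since `x` is not in the tree; below is the parent, which is in the tree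
-- unless `y` is the root, the case excluded by the last hypothesis.
insert : ∀ f t {x y} → y ∈ treeCells f t → Adjacent y x → x ∉ treeCells f t → x ≢ coarse f 0ℤ -1ℤ →
         ∃ λ t′ → treeCells f t′ ↭ x ∷ treeCells f t
insert f (node l u r) {x} (here refl) ad x∉ x≢p with neighbours f 0ℤ 0ℤ ad
... | here refl                         = extend-left f l u r (sprout (leftᶠ f) l (∉-left f l u r x∉))
... | there (here refl)                 = extend-right f l u r (sprout (rightᶠ f) r (∉-right f l u r x∉))
... | there (there (here eq))           = contradiction eq x≢p
... | there (there (there (here refl))) = extend-up f l u r (sprout (upᶠ f) u (∉-up f l u r x∉))
insert f (node l u r) {x} (there y∈) ad x∉ x≢p with ∈-++⁻ (treeCells (leftᶠ f) l) y∈
... | inj₁ y∈l = extend-left f l u r (insert (leftᶠ f) l y∈l ad (∉-left f l u r x∉) (λ eq → x∉ (here eq)))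
... | inj₂ y∈ur with ∈-++⁻ (treeCells (upᶠ f) u) y∈ur
...   | inj₁ y∈u = extend-up f l u r (insert (upᶠ f) u y∈u ad (∉-up f l u r x∉) (λ eq → x∉ (here eq)))
...   | inj₂ y∈r = extend-right f l u r (insert (rightᶠ f) r y∈r ad (∉-right f l u r x∉) (λ eq → x∉ (here eq)))

lowest : ∀ (c : Cell) S → ∃ λ m → m ∈ c ∷ S × (∀ {x} → x ∈ c ∷ S → proj₂ m ℤ.≤ proj₂ x)
lowest c [] = c , here refl , λ where (here refl) → ℤ.≤-refl
lowest c (d ∷ S) with lowest d S
... | m , m∈ , low with ℤ.≤-total (proj₂ c) (proj₂ m)
...   | inj₁ c≤m = c , here refl , λ where
        (here refl) → ℤ.≤-refl
        (there x∈)  → ℤ.≤-trans c≤m (low x∈)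
...   | inj₂ m≤c = m , there m∈ , λ where
        (here refl) → m≤c
        (there x∈)  → low x∈

-- Tilings of regions without blocks

subdivide-resp : ∀ {S S′} → S ↭ S′ → Tiled (subdivide S) → Tiled (subdivide S′)
subdivide-resp e = resp (perm e)
  where
  perm : ∀ {S S′} → S ↭ S′ → subdivide S ↭ subdivide S′
  perm Perm.refl           = ↭-refl
  perm (Perm.prep c e)     = ++⁺ˡ (block (double c)) (perm e)
  perm (Perm.swap c d e)   = ↭-trans (shifts (block (double c)) (block (double d)))
    (++⁺ˡ (block (double d)) (++⁺ˡ (block (double c)) (perm e)))
  perm (Perm.trans e e′)   = ↭-trans (perm e) (perm e′)

length-subdivide : ∀ S → length (subdivide S) ≡ 4 ℕ.* length S
length-subdivide []      = refl
length-subdivide (c ∷ S) = trans (cong (4 ℕ.+_) (length-subdivide S)) (sym (ℕ.*-suc 4 (length S)))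

Tiled-length : ∀ {S} → Tiled S → 3 ∣ length S
Tiled-length []              = divides 0 refl
Tiled-length (tile {T} {S} (b , m , e) p) =
  subst (3 ∣_) (sym (length-++ T)) (∣m∣n⇒∣m+n (divides 1 (ℕ.suc-injective (↭-length e))) (Tiled-length p))
Tiled-length (resp e p)      = subst (3 ∣_) (↭-length e) (Tiled-length p)

-- Any other outcome, completed by a tromino where cells are lacking, tiles `S` together with one or
-- two extra cells, a number of cells not divisible by 3.
Outcome-full : ∀ {F S P Q} → Squares F → 3 ∣ length S → Outcome F S P Q → Tiled S
Outcome-full {F} {S} sq 3∣S = go
  where
  3∤1 : ¬ 3 ∣ 1
  3∤1 d with ℕ.s≤s () ← ∣⇒≤ d
  3∤2 : ¬ 3 ∣ 2
  3∤2 d with ℕ.s≤s (ℕ.s≤s ()) ← ∣⇒≤ d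
  excess : ∀ k → 3 ∣ k ℕ.+ length S → 3 ∣ k
  excess k d = ∣m+n∣m⇒∣n (subst (3 ∣_) (ℕ.+-comm k (length S)) d) 3∣S
  go : ∀ {P Q} → Outcome F S P Q → Tiled S
  go (full p)     = p
  go (either a _) = contradiction (excess 2 (Tiled-length (a (omit₄ (sq 0ℤ 0ℤ))))) 3∤2
  go (left₁ a _)  = contradiction (excess 2 (Tiled-length (a (omit₄ (sq 0ℤ 0ℤ))))) 3∤2
  go (right₁ b _) = contradiction (excess 2 (Tiled-length (b (omit₁ (sq 0ℤ 0ℤ))))) 3∤2
  go (both b)     = contradiction (excess 1 (Tiled-length (b (omit₄ (sq 0ℤ 0ℤ))))) 3∤1
  go (left₂ p _)  = contradiction (excess 1 (Tiled-length p)) 3∤1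
  go (right₂ p _) = contradiction (excess 1 (Tiled-length p)) 3∤1

blockless-tiling : ∀ {S} → NoBlock S → Unique S → Connected S → 3 ∣ length S → Tiled (subdivide S)
blockless-tiling {[]} _ _ _ _ = []
blockless-tiling {S@(s ∷ S₀)} noBlock uniq con 3∣S with lowest s S₀
... | m , m∈S , low = result-of (spread (λ ys → ∃ λ t → treeCells f t ↭ ys) uniq con
        (λ { (t , e) y∈ x∈S x∉ ad →
             let t′ , e′ = insert f t (∈-resp-↭ (↭-sym e) y∈) ad (λ x∈ → x∉ (∈-resp-↭ e x∈)) (above _ x∈S)
             in t′ , ↭-trans e′ (prep _ e) })
        (proj₁ (extract m∈S)) (proj₂ (extract m∈S))
        (node nil nil nil , ↭-reflexive (cong [_] (cong₂ _,_ (ℤ.+-identityʳ _) (ℤ.+-identityʳ _)))))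
  where
  f = frameAt m
  -- The row below the lowest cell `m` misses `S`. It contains the parent position of the root,
  -- which `insert` must avoid, and the two cells that `treeOutcome` requires to be absent.
  above : ∀ i {x} → x ∈ S → x ≢ (i , proj₂ m + -1ℤ)
  above _ x∈S refl = ℤ.<-irrefl refl (ℤ.<-≤-trans
    (subst (ℤ._< proj₂ m) (ℤ.+-comm -1ℤ (proj₂ m)) (ℤ.i≤pred[j]⇒i<j ℤ.≤-refl)) (low x∈S))
  result-of : (∃ λ S′ → S′ ↭ S × ∃ λ t → treeCells f t ↭ S′) → Tiled (subdivide S)
  result-of (S′ , e′ , t , e) = subdivide-resp e″ (resp (↭-sym (subdivide-cells f t))
    (Outcome-full (fine-squares f) (subst (3 ∣_) count (∣n⇒∣m*n 4 3∣S))
      (treeOutcome noBlock f t (∈-resp-↭ e″) (λ _ x∈ → above _ x∈ refl) (λ _ x∈ → above _ x∈ refl))))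
    where
    e″ = ↭-trans e e′
    count : 4 ℕ.* length S ≡ length (fineCells f t)
    count = trans (cong (4 ℕ.*_) (sym (↭-length e″)))
              (trans (sym (length-subdivide (treeCells f t))) (↭-length (subdivide-cells f t)))

-- Splitting a region that contains a block

data Interval (a b c : ℕ) : Set where
  [a] : 3 ∣ a → Interval a b c
  [b] : 3 ∣ b → Interval a b c
  [c] : 3 ∣ c → Interval a b c
  [ab] : 3 ∣ a ℕ.+ b → Interval a b c
  [bc] : 3 ∣ b ℕ.+ c → Interval a b c
  [abc] : 3 ∣ a ℕ.+ (b ℕ.+ c) → Interval a b c

-- Two of the four prefix sums 0, `a`, `a + b`, `a + b + c` agree mod 3. The fourth part thus always
-- belongs to the complement of the chosen interval.
interval : ∀ a b c → Interval a b c
interval a b c with a divMod 3 | b divMod 3 | c divMod 3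
... | result i zero eq | _ | _ = [a] (divides i eq)
... | _ | result j zero eq | _ = [b] (divides j eq)
... | _ | _ | result k zero eq = [c] (divides k eq)
-- With no remainder 0, either two consecutive remainders are 1 and 2 in some order, or all three
-- are equal.
... | result i (suc zero) refl | result j (suc (suc zero)) refl | _ = [ab] (divides (1 ℕ.+ i ℕ.+ j) (eq i j))
  where
  eq : ∀ i j → (1 ℕ.+ i ℕ.* 3) ℕ.+ (2 ℕ.+ j ℕ.* 3) ≡ (1 ℕ.+ i ℕ.+ j) ℕ.* 3
  eq = ℕ.solve-∀
... | result i (suc (suc zero)) refl | result j (suc zero) refl | _ = [ab] (divides (1 ℕ.+ i ℕ.+ j) (eq i j))
  where
  eq : ∀ i j → (2 ℕ.+ i ℕ.* 3) ℕ.+ (1 ℕ.+ j ℕ.* 3) ≡ (1 ℕ.+ i ℕ.+ j) ℕ.* 3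
  eq = ℕ.solve-∀
... | _ | result j (suc zero) refl | result k (suc (suc zero)) refl = [bc] (divides (1 ℕ.+ j ℕ.+ k) (eq j k))
  where
  eq : ∀ i j → (1 ℕ.+ i ℕ.* 3) ℕ.+ (2 ℕ.+ j ℕ.* 3) ≡ (1 ℕ.+ i ℕ.+ j) ℕ.* 3
  eq = ℕ.solve-∀
... | _ | result j (suc (suc zero)) refl | result k (suc zero) refl = [bc] (divides (1 ℕ.+ j ℕ.+ k) (eq j k))
  where
  eq : ∀ i j → (2 ℕ.+ i ℕ.* 3) ℕ.+ (1 ℕ.+ j ℕ.* 3) ≡ (1 ℕ.+ i ℕ.+ j) ℕ.* 3
  eq = ℕ.solve-∀
... | result i (suc zero) refl | result j (suc zero) refl | result k (suc zero) refl =
  [abc] (divides (1 ℕ.+ i ℕ.+ (j ℕ.+ k)) (eq i j k))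
  where
  eq : ∀ i j k → (1 ℕ.+ i ℕ.* 3) ℕ.+ ((1 ℕ.+ j ℕ.* 3) ℕ.+ (1 ℕ.+ k ℕ.* 3)) ≡ (1 ℕ.+ i ℕ.+ (j ℕ.+ k)) ℕ.* 3
  eq = ℕ.solve-∀
... | result i (suc (suc zero)) refl | result j (suc (suc zero)) refl | result k (suc (suc zero)) refl =
  [abc] (divides (2 ℕ.+ i ℕ.+ (j ℕ.+ k)) (eq i j k))
  where
  eq : ∀ i j k → (2 ℕ.+ i ℕ.* 3) ℕ.+ ((2 ℕ.+ j ℕ.* 3) ℕ.+ (2 ℕ.+ k ℕ.* 3)) ≡ (2 ℕ.+ i ℕ.+ (j ℕ.+ k)) ℕ.* 3
  eq = ℕ.solve-∀

record Split (S : List Cell) : Set where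
  field
    {part₁ part₂} : List Cell
    {cell₁ cell₂} : Cell
    whole      : part₁ ++ part₂ ↭ S
    nonempty₁  : cell₁ ∈ part₁
    nonempty₂  : cell₂ ∈ part₂
    connected₁ : Connected part₁
    connected₂ : Connected part₂
    divisible₁ : 3 ∣ length part₁

Connected-∷ : ∀ {S y x} → Connected S → y ∈ S → Adjacent y x → Connected (x ∷ S)
Connected-∷ {y = y} {x} con y∈ ad = Connected-++ Connected-[ x ] con (here refl) y∈ (Adjacent-sym y x ad)

record Part (a : Cell) : Set where
  constructor part
  field
    members   : List Cell
    seed∈     : a ∈ members
    linked    : Connected members
open Part

singleton : ∀ a → Part a
singleton a = part [ a ] (here refl) Connected-[ a ]

add : ∀ {a y} (A : Part a) x → y ∈ members A → Adjacent y x → Part a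
add (part S a∈ con) x y∈ ad = part (x ∷ S) (there a∈) (Connected-∷ con y∈ ad)

record Quarters (a b c d : Cell) (S : List Cell) : Set where
  constructor quarters
  field
    partA : Part a
    partB : Part b
    partC : Part c
    partD : Part d
    whole : members partA ++ members partB ++ members partC ++ members partD ↭ S

-- The new cell joins the part of its neighbour `y`, which stays connected.
quarters-step : ∀ {a b c d ys y x} → Quarters a b c d ys → y ∈ ys → Adjacent y x → Quarters a b c d (x ∷ ys)
quarters-step {ys = ys} {y} {x} (quarters A B C D whole) y∈ys ad = place (∈-++⁻ SA (∈-resp-↭ (↭-sym whole) y∈ys))
  where
  SA = members A
  SB = members B
  SC = members C
  SD = members D
  place : y ∈ SA ⊎ y ∈ SB ++ SC ++ SD → Quarters _ _ _ _ (x ∷ ys)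
  place (inj₁ y∈) = quarters (add A x y∈ ad) B C D (prep x whole)
  place (inj₂ y∈) with ∈-++⁻ SB y∈
  ... | inj₁ y∈ = quarters A (add B x y∈ ad) C D (↭-trans (shift x SA (SB ++ SC ++ SD)) (prep x whole))
  ... | inj₂ y∈ with ∈-++⁻ SC y∈
  ...   | inj₁ y∈ = quarters A B (add C x y∈ ad) D (↭-trans
    (solve 5 (λ x A B C D → (A ⊕ B ⊕ x ⊕ C ⊕ D) ⊜ (x ⊕ A ⊕ B ⊕ C ⊕ D)) ↭-refl [ x ] SA SB SC SD) (prep x whole))
  ...   | inj₂ y∈ = quarters A B C (add D x y∈ ad) (↭-trans
    (solve 5 (λ x A B C D → (A ⊕ B ⊕ C ⊕ x ⊕ D) ⊜ (x ⊕ A ⊕ B ⊕ C ⊕ D)) ↭-refl [ x ] SA SB SC SD) (prep x whole))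

-- The seeds form a 4-cycle, so every cyclic interval of parts is connected, and so is its
-- complement, again a cyclic interval.
quarters-split : ∀ {a b c d S} → Quarters a b c d S →
                 Adjacent a b → Adjacent b c → Adjacent c d → Adjacent d a → Split S
quarters-split {S = S} (quarters (part Sa a∈ conA) (part Sb b∈ conB)
                                 (part Sc c∈ conC) (part Sd d∈ conD) whole) ab bc cd da =
  go (interval (length Sa) (length Sb) (length Sc))
  where
  conAB : Connected (Sa ++ Sb)
  conAB = Connected-++ conA conB a∈ b∈ ab
  conBC : Connected (Sb ++ Sc)
  conBC = Connected-++ conB conC b∈ c∈ bc
  conCD : Connected (Sc ++ Sd)
  conCD = Connected-++ conC conD c∈ d∈ cd
  go : Interval (length Sa) (length Sb) (length Sc) → Split S
  go ([a] div) = record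
    { whole = whole
    ; nonempty₁ = a∈ ; nonempty₂ = ∈-++⁺ˡ b∈
    ; connected₁ = conA ; connected₂ = Connected-++ conB conCD b∈ (∈-++⁺ˡ c∈) bc
    ; divisible₁ = div }
  go ([b] div) = record
    { part₁ = Sb ; part₂ = Sc ++ Sd ++ Sa
    ; whole = ↭-trans (solve 4 (λ A B C D → (B ⊕ C ⊕ D ⊕ A) ⊜ (A ⊕ B ⊕ C ⊕ D)) ↭-refl Sa Sb Sc Sd) whole
    ; nonempty₁ = b∈ ; nonempty₂ = ∈-++⁺ˡ c∈
    ; connected₁ = conB
    ; connected₂ = Connected-++ conC (Connected-++ conD conA d∈ a∈ da) c∈ (∈-++⁺ˡ d∈) cd
    ; divisible₁ = div }
  go ([c] div) = record
    { part₁ = Sc ; part₂ = Sd ++ Sa ++ Sb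
    ; whole = ↭-trans (solve 4 (λ A B C D → (C ⊕ D ⊕ A ⊕ B) ⊜ (A ⊕ B ⊕ C ⊕ D)) ↭-refl Sa Sb Sc Sd) whole
    ; nonempty₁ = c∈ ; nonempty₂ = ∈-++⁺ˡ d∈
    ; connected₁ = conC
    ; connected₂ = Connected-++ conD conAB d∈ (∈-++⁺ˡ a∈) da
    ; divisible₁ = div }
  go ([ab] div) = record
    { part₁ = Sa ++ Sb ; part₂ = Sc ++ Sd
    ; whole = ↭-trans (++-assoc Sa Sb (Sc ++ Sd)) whole
    ; nonempty₁ = ∈-++⁺ˡ a∈ ; nonempty₂ = ∈-++⁺ˡ c∈
    ; connected₁ = conAB ; connected₂ = conCD
    ; divisible₁ = subst (3 ∣_) (sym (length-++ Sa)) div }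
  go ([bc] div) = record
    { part₁ = Sb ++ Sc ; part₂ = Sd ++ Sa
    ; whole = ↭-trans (solve 4 (λ A B C D → ((B ⊕ C) ⊕ D ⊕ A) ⊜ (A ⊕ B ⊕ C ⊕ D)) ↭-refl Sa Sb Sc Sd) whole
    ; nonempty₁ = ∈-++⁺ˡ b∈ ; nonempty₂ = ∈-++⁺ˡ d∈
    ; connected₁ = conBC ; connected₂ = Connected-++ conD conA d∈ a∈ da
    ; divisible₁ = subst (3 ∣_) (sym (length-++ Sb)) div }
  go ([abc] div) = record
    { part₁ = Sa ++ Sb ++ Sc ; part₂ = Sd
    ; whole = ↭-trans (solve 4 (λ A B C D → ((A ⊕ B ⊕ C) ⊕ D) ⊜ (A ⊕ B ⊕ C ⊕ D)) ↭-refl Sa Sb Sc Sd) whole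
    ; nonempty₁ = ∈-++⁺ˡ a∈ ; nonempty₂ = d∈
    ; connected₁ = Connected-++ conA conBC a∈ (∈-++⁺ˡ b∈) ab ; connected₂ = conD
    ; divisible₁ = subst (3 ∣_) (sym (trans (length-++ Sa) (cong (length Sa ℕ.+_) (length-++ Sb)))) div }

i≢i+1 : ∀ i → i ≢ i + 1ℤ
i≢i+1 i eq with trans (sym (ℤ.+-inverseʳ i)) (trans (cong (_- i) eq) (law i))
  where
  law : ∀ i → (i + 1ℤ) - i ≡ 1ℤ
  law = solve-∀
... | ()

block-unique : ∀ b → Unique (block b)
block-unique (i , j) = Unique.cartesianProduct⁺ (pair i) (pair j)
  where
  pair : ∀ i → Unique (i ∷ i + 1ℤ ∷ [])
  pair i = (i≢i+1 i ∷ []) ∷ [] ∷ []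

block-split : ∀ {S} → Unique S → Connected S → ∀ b → All (_∈ S) (block b) → Split S
block-split uniq con b@(i , j) b⊆S with extracts (block-unique b) b⊆S
... | zs , e with spread (Quarters (i , j) (i , j + 1ℤ) (i + 1ℤ , j + 1ℤ) (i + 1ℤ , j)) uniq con
                    (λ q y∈ _ _ ad → quarters-step q y∈ ad) zs e start
  where
  start : Quarters (i , j) (i , j + 1ℤ) (i + 1ℤ , j + 1ℤ) (i + 1ℤ , j) (block b)
  -- The seeds go around the block, whereas `block` lists the last two cells in the other order.
  start = quarters (singleton _) (singleton _) (singleton _) (singleton _) (prep _ (prep _ (swap _ _ ↭-refl)))
... | S′ , e′ , q = quarters-split (record { Quarters q hiding (whole); whole = ↭-trans (Quarters.whole q) e′ })
        (vertical i) (horizontal (j + 1ℤ)) (Adjacent-sym (i + 1ℤ , j) (i + 1ℤ , j + 1ℤ) (vertical (i + 1ℤ)))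
        (Adjacent-sym (i , j) (i + 1ℤ , j) (horizontal j))
  where
  law : ∀ i → i - (i + 1ℤ) ≡ -1ℤ
  law = solve-∀
  vertical : ∀ i → Adjacent (i , j) (i , j + 1ℤ)
  vertical i = cong₂ (λ m n → ∣ m ∣ ℕ.+ ∣ n ∣) (ℤ.+-inverseʳ i) (law j)
  horizontal : ∀ j → Adjacent (i , j) (i + 1ℤ , j)
  horizontal j = cong₂ (λ m n → ∣ m ∣ ℕ.+ ∣ n ∣) (law i) (ℤ.+-inverseʳ j)

-- Induction on the number of cells

Split-tiling : ∀ {S} → Unique S → 3 ∣ length S → Split S →
               (∀ {S′} → length S′ ℕ.< length S → Unique S′ → Connected S′ → 3 ∣ length S′ → Tiled (subdivide S′)) →
               Tiled (subdivide S)
Split-tiling {S} uniq 3∣S split tiling = subdivide-resp whole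
  (subst Tiled (sym (concatMap-++ (block ∘ double) part₁ part₂))
    (tiling lt₁ uniq₁ connected₁ divisible₁ ++ᵗ tiling lt₂ uniq₂ connected₂ divisible₂))
  where
  open Split split
  total : length part₁ ℕ.+ length part₂ ≡ length S
  total = trans (sym (length-++ part₁)) (↭-length whole)
  lt₁ : length part₁ ℕ.< length S
  lt₁ = subst (length part₁ ℕ.<_) total (ℕ.m<m+n (length part₁) (∈-length nonempty₂))
  lt₂ : length part₂ ℕ.< length S
  lt₂ = subst (length part₂ ℕ.<_) total (ℕ.m<n+m (length part₂) (∈-length nonempty₁))
  uniq₁ : Unique part₁
  uniq₁ = proj₁ (Unique-++⁻ part₁ (Unique-resp-↭ (↭-sym whole) uniq))
  uniq₂ : Unique part₂
  uniq₂ = proj₁ (proj₂ (Unique-++⁻ part₁ (Unique-resp-↭ (↭-sym whole) uniq)))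
  divisible₂ : 3 ∣ length part₂
  divisible₂ = ∣m+n∣m⇒∣n (subst (3 ∣_) (sym total) 3∣S) divisible₁

-- A block inside `S` is labelled by its first cell, so only the cells of `S` need to be searched.
findBlock : ∀ S → NoBlock S ⊎ ∃ λ b → All (_∈ S) (block b)
findBlock S with any? (λ b → All.all? (_∈? S) (block b)) S
... | no ¬block  = inj₁ (λ b b⊆S → ¬block (lose (All.head b⊆S) b⊆S))
... | yes block∈ = inj₂ (Any.satisfied block∈)

connected-tiling : ∀ n {S} → length S ℕ.< n → Unique S → Connected S → 3 ∣ length S → Tiled (subdivide S)
connected-tiling (ℕ.suc n) {S} S<n uniq con 3∣S with findBlock S
... | inj₁ noBlock   = blockless-tiling noBlock uniq con 3∣S
... | inj₂ (b , b⊆S) = Split-tiling uniq 3∣S (block-split uniq con b b⊆S)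
        (λ lt → connected-tiling n (ℕ.≤-trans lt (ℕ.s≤s⁻¹ S<n)))

-- Covers

2i≢1 : ∀ i → + 2 * i ≢ 1ℤ
2i≢1 i eq = ℕ.<⇒≱ (ℕ.n<1+n 1) (∣⇒≤ {1} {2} (divides ∣ i ∣
  (trans (sym (cong ∣_∣ eq)) (trans (ℤ.abs-* (+ 2) i) (ℕ.*-comm 2 ∣ i ∣)))))

2i≢2j+1 : ∀ i j → + 2 * i ≢ + 2 * j + 1ℤ
2i≢2j+1 i j eq = 2i≢1 (i - j) (trans (*-distrib i j) (trans (cong (_- + 2 * j) eq) (cancel j)))
  where
  *-distrib : ∀ i j → + 2 * (i - j) ≡ + 2 * i - + 2 * j
  *-distrib = solve-∀
  cancel : ∀ j → (+ 2 * j + 1ℤ) - + 2 * j ≡ 1ℤ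
  cancel = solve-∀

-- By parity: `i` and `j` are both half of `x`, rounded down.
half-unique : ∀ i j {x} → x ∈ + 2 * i ∷ + 2 * i + 1ℤ ∷ [] → x ∈ + 2 * j ∷ + 2 * j + 1ℤ ∷ [] → i ≡ j
half-unique i j (here p)         (here q)         = ℤ.*-cancelˡ-≡ (+ 2) i j (trans (sym p) q)
half-unique i j (here p)         (there (here q)) = contradiction (trans (sym p) q) (2i≢2j+1 i j)
half-unique i j (there (here p)) (here q)         = contradiction (trans (sym q) p) (2i≢2j+1 j i)
half-unique i j (there (here p)) (there (here q)) =
  ℤ.*-cancelˡ-≡ (+ 2) i j (∙-cancelʳ 1ℤ _ _ (trans (sym p) q))

double-blocks-disjoint : ∀ {c d} → c ≢ d → Disjoint (block (double c)) (block (double d))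
double-blocks-disjoint {i , j} {i′ , j′} c≢d (x∈ , y∈)
  with ∈-cartesianProduct⁻ _ _ x∈ | ∈-cartesianProduct⁻ _ _ y∈
... | p , q | p′ , q′ = c≢d (cong₂ _,_ (half-unique i i′ p p′) (half-unique j j′ q q′))

subdivide-unique : ∀ {S} → Unique S → Unique (subdivide S)
subdivide-unique {S} u = Unique.concat⁺ (All.map⁺ (All.universal (block-unique ∘ double) S))
  (AllPairs.map⁺ (AllPairs.map double-blocks-disjoint u))

Tromino⇒IsLTromino : ∀ {T} → Tromino T → IsLTromino T
Tromino⇒IsLTromino {T} (b , m , e) = b , m , ∈-resp-↭ e (here refl) , λ c → mk⇔
  (λ c∈ → ∈-resp-↭ e (there c∈) , λ { refl → All.lookup (AllPairs.head uniq) c∈ refl })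
  (λ (c∈ , c≢m) → Any.tail c≢m (∈-resp-↭ (↭-sym e) c∈))
  where
  uniq : Unique (m ∷ T)
  uniq = Unique-resp-↭ (↭-sym e) (block-unique b)

-- `IsLTromino` speaks of membership only, so `T` may repeat cells; `T′` is a duplicate-free list of
-- the same cells.
IsLTromino⇒Tromino : ∀ {T} → IsLTromino T → ∃ λ T′ → Tromino T′ × Unique T′ × T ∼[ set ] T′
IsLTromino⇒Tromino {T} (b , m , m∈ , T≈) with extract m∈
... | T′ , e = T′ , (b , m , e) , AllPairs.tail uniq , λ {c} → mk⇔
  (λ c∈ → let c∈b , c≢m = Equivalence.to (T≈ c) c∈ in Any.tail c≢m (∈-resp-↭ (↭-sym e) c∈b))
  (λ c∈ → Equivalence.from (T≈ c) (∈-resp-↭ e (there c∈) , λ { refl → All.lookup (AllPairs.head uniq) c∈ refl }))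
  where
  uniq : Unique (m ∷ T′)
  uniq = Unique-resp-↭ (↭-sym e) (block-unique b)

Tiled⇒pieces : ∀ {S} → Tiled S → ∃ λ ts → All Tromino ts × concat ts ↭ S
Tiled⇒pieces []         = [] , [] , ↭-refl
Tiled⇒pieces (tile {T} t p) with Tiled⇒pieces p
... | ts , tr , e = T ∷ ts , t ∷ tr , ++⁺ˡ T e
Tiled⇒pieces (resp e p) with Tiled⇒pieces p
... | ts , tr , e′ = ts , tr , ↭-trans e′ e

concat-disjoint⁻ : ∀ (ts : List (List Cell)) → Unique (concat ts) → AllPairs Disjoint ts
concat-disjoint⁻ []       _ = []
concat-disjoint⁻ (t ∷ ts) u with Unique-++⁻ t u
... | _ , u′ , d = All.tabulate (λ {s} s∈ (x∈t , x∈s) → d (x∈t , ∈-concat⁺′ x∈s s∈)) ∷ concat-disjoint⁻ ts u′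

Tiled⇒Cover : ∀ {S} → Unique S → Tiled S → Cover S
Tiled⇒Cover u p with Tiled⇒pieces p
... | ts , tr , e = record
  { pieces    = ts
  ; trominoes = All.map Tromino⇒IsLTromino tr
  ; disjoint  = concat-disjoint⁻ ts (Unique-resp-↭ (↭-sym e) u)
  ; union     = bag-=⇒ (↭⇒∼bag e)
  }

-- Each piece is replaced by its duplicate-free version; disjointness of the pieces then keeps the
-- concatenation duplicate-free.
concat-Tiled : ∀ {ts} → All IsLTromino ts → AllPairs Disjoint ts →
               ∃ λ S → Tiled S × Unique S × concat ts ∼[ set ] S
concat-Tiled []        []      = [] , [] , [] , mk⇔ id id
concat-Tiled {t ∷ ts} (tr ∷ trs) (d ∷ ds) with IsLTromino⇒Tromino tr | concat-Tiled trs ds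
... | T , T-tromino , T-unique , t≈T | S , S-tiled , S-unique , ts≈S =
  T ++ S , tile T-tromino S-tiled , Unique.++⁺ T-unique S-unique disj , ++-cong t≈T ts≈S
  where
  disj : Disjoint T S
  disj (x∈T , x∈S) with ∈-concat⁻′ ts (Equivalence.from ts≈S x∈S)
  ... | s , x∈s , s∈ts = All.lookup d s∈ts (Equivalence.from t≈T x∈T , x∈s)

Cover⇒Tiled : ∀ {S} → Unique S → Cover S → Tiled S
Cover⇒Tiled u c with concat-Tiled (Cover.trominoes c) (Cover.disjoint c)
-- Duplicate-free lists with the same members are permutations of each other.
... | S′ , tiled , u′ , eq = resp (∼bag⇒↭ (unique∧set⇒bag u′ u (mk⇔
  (Equivalence.to (Cover.union c) ∘ Equivalence.from eq) (Equivalence.to eq ∘ Equivalence.from (Cover.union c))))) tiled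

theorem7 : (R : Region) (n : ℕ) → size R ≡ n → Cover (R ⊞) ⇔ 3 ∣ n
theorem7 R n refl = mk⇔
  -- The length `4 ℕ.* n` unfolds to `n ℕ.+ 3 ℕ.* n`, from which the multiple of 3 is removed.
  (λ cover → ∣m+n∣m⇒∣n (subst (3 ∣_) (trans (length-subdivide (cells R)) (ℕ.+-comm n (3 ℕ.* n)))
      (Tiled-length (Cover⇒Tiled R⊞-unique cover)))
    (divides n (ℕ.*-comm 3 n)))
  (λ 3∣n → Tiled⇒Cover R⊞-unique (connected-tiling (ℕ.suc n) ℕ.≤-refl (unique R) (connected R) 3∣n))
  where
  R⊞-unique : Unique (R ⊞)
  R⊞-unique = subdivide-unique (unique R)
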